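{- A computable equivalence structure $\mathcal{A}$ is computably bi-embeddably categorical if and only if it has finitely many infinite equivalence classes and bounded character.
   Context: An equivalence structure $\mathcal{A}=(A,E)$ has universe $A\subseteq\omega$ and an equivalence relation $E$; it is computable if its atomic diagram is computable. Two structures are bi-embeddable if each embeds into the other. A computable structure $\mathcal{A}$ is computably bi-embeddably categorical if for every computable structure $\mathcal{B}$ bi-embeddable with $\mathcal{A}$ there are computable embeddings $\mathcal{A}\hookrightarrow\mathcal{B}$ and $\mathcal{B}\hookrightarrow\mathcal{A}$. $\mathcal{A}$ has bounded character if there is a finite $k$ such that every finite equivalence class of $\mathcal{A}$ has size at most $k$. -}

module Defs where

open import Level using (0ℓ)
open import Data.Nat using (ℕ; zero; suc; _<_; _≤_)
open import Data.Fin using (Fin)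
open import Data.Vec using (Vec; []; _∷_; lookup)
open import Data.List using (List; length)
open import Data.List.Membership.Propositional using (_∈_)
open import Data.List.Relation.Unary.Any using (Any)
open import Data.Product using (Σ; _×_; _,_; ∃)
open import Data.Sum using (_⊎_)
open import Relation.Nullary using (¬_)
open import Relation.Binary.PropositionalEquality using (_≡_)

data Code : ℕ → Set where
  zeroF : ∀ {n} → Code n
  succF : Code 1
  proj  : ∀ {n} → Fin n → Code n
  comp  : ∀ {m n} → Code m → Vec (Code n) m → Code n
  prec  : ∀ {n} → Code n → Code (suc (suc n)) → Code (suc n)
  mu    : ∀ {n} → Code (suc n) → Code n

mutual
  data Eval : ∀ {n} → Code n → Vec ℕ n → ℕ → Set where
    ev-zero : ∀ {n} {xs : Vec ℕ n} → Eval zeroF xs 0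
    ev-succ : ∀ {x} → Eval succF (x ∷ []) (suc x)
    ev-proj : ∀ {n} {i : Fin n} {xs : Vec ℕ n} → Eval (proj i) xs (lookup xs i)
    ev-comp : ∀ {m n} {f : Code m} {gs : Vec (Code n) m} {xs : Vec ℕ n}
                {ys : Vec ℕ m} {v : ℕ} →
              EvalAll gs xs ys → Eval f ys v → Eval (comp f gs) xs v
    ev-prec-zero : ∀ {n} {g : Code n} {h : Code (suc (suc n))} {xs : Vec ℕ n} {v : ℕ} →
              Eval g xs v → Eval (prec g h) (zero ∷ xs) v
    ev-prec-suc : ∀ {n} {g : Code n} {h : Code (suc (suc n))} {xs : Vec ℕ n}
                    {y u v : ℕ} →
              Eval (prec g h) (y ∷ xs) u → Eval h (y ∷ u ∷ xs) v →
              Eval (prec g h) (suc y ∷ xs) v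
    ev-mu : ∀ {n} {f : Code (suc n)} {xs : Vec ℕ n} {y : ℕ} →
              Eval f (y ∷ xs) 0 →
              (∀ z → z < y → Σ ℕ (λ k → Eval f (z ∷ xs) (suc k))) →
              Eval (mu f) xs y

  data EvalAll : ∀ {m n} → Vec (Code n) m → Vec ℕ n → Vec ℕ m → Set where
    ev-[] : ∀ {n} {xs : Vec ℕ n} → EvalAll [] xs []
    ev-∷  : ∀ {m n} {g : Code n} {gs : Vec (Code n) m} {xs : Vec ℕ n} {y : ℕ}
              {ys : Vec ℕ m} →
            Eval g xs y → EvalAll gs xs ys → EvalAll (g ∷ gs) xs (y ∷ ys)

ComputableFun : (ℕ → ℕ) → Set
ComputableFun f = Σ (Code 1) λ c → ∀ x → Eval c (x ∷ []) (f x)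

record EqStructure : Set₁ where
  field
    Dom   : ℕ → Set
    E     : ℕ → ℕ → Set
    reflE  : ∀ {x} → Dom x → E x x
    symE   : ∀ {x y} → Dom x → Dom y → E x y → E y x
    transE : ∀ {x y z} → Dom x → Dom y → Dom z → E x y → E y z → E x z
open EqStructure public

-- Computable: the atomic diagram is computable, i.e. the universe and
-- the relation E (on the universe) have computable characteristic functions.
Computable : EqStructure → Set
Computable 𝒜 =
  Σ (Code 1) (λ c → ∀ x →
      (Dom 𝒜 x × Eval c (x ∷ []) 1) ⊎ (¬ Dom 𝒜 x × Eval c (x ∷ []) 0))
  × Σ (Code 2) (λ c → ∀ x y → Dom 𝒜 x → Dom 𝒜 y →
      (E 𝒜 x y × Eval c (x ∷ y ∷ []) 1) ⊎ (¬ E 𝒜 x y × Eval c (x ∷ y ∷ []) 0))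

IsEmbedding : (𝒜 ℬ : EqStructure) → (ℕ → ℕ) → Set
IsEmbedding 𝒜 ℬ f =
    (∀ x → Dom 𝒜 x → Dom ℬ (f x))
  × (∀ x y → Dom 𝒜 x → Dom 𝒜 y → f x ≡ f y → x ≡ y)
  × (∀ x y → Dom 𝒜 x → Dom 𝒜 y → (E 𝒜 x y → E ℬ (f x) (f y))
                                  × (E ℬ (f x) (f y) → E 𝒜 x y))

_↪_ : EqStructure → EqStructure → Set
𝒜 ↪ ℬ = Σ (ℕ → ℕ) (IsEmbedding 𝒜 ℬ)

_↪c_ : EqStructure → EqStructure → Set
𝒜 ↪c ℬ = Σ (ℕ → ℕ) (λ f → IsEmbedding 𝒜 ℬ f × ComputableFun f)

BiEmbeddable : EqStructure → EqStructure → Set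
BiEmbeddable 𝒜 ℬ = (𝒜 ↪ ℬ) × (ℬ ↪ 𝒜)

ComputablyBiEmbeddablyCategorical : EqStructure → Set₁
ComputablyBiEmbeddablyCategorical 𝒜 =
  (ℬ : EqStructure) → Computable ℬ → BiEmbeddable 𝒜 ℬ → (𝒜 ↪c ℬ) × (ℬ ↪c 𝒜)

Covers : EqStructure → ℕ → List ℕ → Set
Covers 𝒜 x l = ∀ y → Dom 𝒜 y → E 𝒜 x y → y ∈ l

FiniteClass : EqStructure → ℕ → Set
FiniteClass 𝒜 x = Σ (List ℕ) (Covers 𝒜 x)

InfiniteClass : EqStructure → ℕ → Set
InfiniteClass 𝒜 x = ¬ FiniteClass 𝒜 x

ClassSizeAtMost : EqStructure → ℕ → ℕ → Set
ClassSizeAtMost 𝒜 x k = Σ (List ℕ) (λ l → Covers 𝒜 x l × length l ≤ k)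

FinitelyManyInfiniteClasses : EqStructure → Set
FinitelyManyInfiniteClasses 𝒜 =
  Σ (List ℕ) λ reps → ∀ x → Dom 𝒜 x → InfiniteClass 𝒜 x →
    Any (λ r → Dom 𝒜 r × E 𝒜 x r) reps

BoundedCharacter : EqStructure → Set
BoundedCharacter 𝒜 =
  Σ ℕ λ k → ∀ x → Dom 𝒜 x → FiniteClass 𝒜 x → ClassSizeAtMost 𝒜 x k

{-# OPTIONS --safe #-}
-- Both conditions together say that, for some m, all but finitely many classes of 𝒜
-- have size less than m; this passes to every structure embedding into 𝒜.
--
-- Sufficiency. Take m least. The finitely many exceptional classes are mapped as a given
-- embedding h maps them, which is finite information. If classes of size at least m - 1
-- occur infinitely often in 𝒜, then also in ℬ and off the images under h, so their
-- (m - 1)-th elements form an infinite computable set whose n-th element can receive the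
-- class with least element n. Inside a class, elements are matched by position.
--
-- Necessity. Let t be the time after which the program e, run on e, returns 0; by
-- diagonalisation no computable function of e bounds t. If 𝒜 has infinitely many
-- infinite classes, it is bi-embeddable with any structure that does: from one with all
-- classes infinite, categoricity gives a computable embedding via 𝒜 into one whose
-- infinite classes are the true stages of the enumeration of the halting e (Dekker), and
-- a computable sequence of true stages bounds t. If all but finitely many classes are
-- finite but of unbounded size, those classes may be replaced by classes of size about t
-- or by classes of size 1, 2, 3, …; a computable embedding of the former via 𝒜 into the
-- latter again bounds t.
module Submission where

open import Defs
open import Level using (0ℓ)
open import Axiom.ExcludedMiddle using (ExcludedMiddle)
open import Data.Empty using (⊥; ⊥-elim)
open import Data.Fin using (Fin; zero; suc)
open import Data.List using (List; []; _∷_; _++_; length; downFrom)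
import Data.List as List
open import Data.List.Membership.Propositional using (_∈_; lose)
open import Data.List.Membership.Propositional.Properties using (∈-map⁺; ∈-downFrom⁺)
open import Data.List.Properties using (length-downFrom)
open import Data.List.Relation.Unary.Any as Any using (Any; here; there)
open import Data.List.Relation.Unary.Any.Properties using (++⁺ˡ; ++⁺ʳ)
open import Data.Nat
open import Data.Nat.Properties
open import Data.Product using (Σ; _×_; _,_; proj₁; proj₂)
open import Data.Sum using (_⊎_; inj₁; inj₂; [_,_]′)
open import Data.Vec using (Vec; []; _∷_; lookup; map; tabulate)
open import Data.Vec.Properties using (tabulate∘lookup; tabulate-∘)
open import Function using (_∘_; id)
open import Function.Bundles using (_⇔_; mk⇔)
open import Relation.Binary.Definitions using (tri<; tri≈; tri>)
open import Relation.Binary.PropositionalEquality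
open import Relation.Nullary using (¬_; Dec; yes; no)

private variable
  m n : ℕ

-- Total computable functions

-- Function, code and correctness travel together, so an expression built from these combinators is
-- computable by construction.
record Fn (n : ℕ) : Set where
  constructor mkFn
  field
    fun  : Vec ℕ n → ℕ
    code : Code n
    eval : ∀ xs → Eval code xs (fun xs)
open Fn

app₁ : Fn 1 → ℕ → ℕ
app₁ f x = fun f (x ∷ [])

app₂ : Fn 2 → ℕ → ℕ → ℕ
app₂ f x y = fun f (x ∷ y ∷ [])

-- Keeps the code but replaces the function by a readable equal one, to which `fun` then reduces.
withFun : (f : Fn n) (g : Vec ℕ n → ℕ) → (∀ xs → fun f xs ≡ g xs) → Fn n
withFun f g eq = mkFn g (code f) λ xs → subst (Eval (code f) xs) (eq xs) (eval f xs)

infixl 9 _⟦_⟧ _∘ᶠ_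
_⟦_⟧ : Fn m → Vec (Fn n) m → Fn n
_⟦_⟧ {m} {n} f gs = mkFn
  (λ xs → fun f (map (λ g → fun g xs) gs))
  (comp (code f) (map code gs))
  (λ xs → ev-comp (evalAll gs xs) (eval f _))
  where
  evalAll : ∀ {k} (gs : Vec (Fn n) k) xs → EvalAll (map code gs) xs (map (λ g → fun g xs) gs)
  evalAll []       xs = ev-[]
  evalAll (g ∷ gs) xs = ev-∷ (eval g xs) (evalAll gs xs)

_∘ᶠ_ : Fn 1 → Fn 1 → Fn 1
g ∘ᶠ f = g ⟦ f ∷ [] ⟧

var : Fin n → Fn n
var i = mkFn (λ xs → lookup xs i) (proj i) (λ _ → ev-proj)

v0 : Fn (1 + n)
v0 = var zero
v1 : Fn (2 + n)
v1 = var (suc zero)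
v2 : Fn (3 + n)
v2 = var (suc (suc zero))
v3 : Fn (4 + n)
v3 = var (suc (suc (suc zero)))
v4 : Fn (5 + n)
v4 = var (suc (suc (suc (suc zero))))

sucᶠ : Fn n → Fn n
sucᶠ a = mkFn (λ xs → suc (fun a xs)) (comp succF (code a ∷ []))
  (λ xs → ev-comp (ev-∷ (eval a xs) ev-[]) ev-succ)

const : ℕ → Fn n
const k = mkFn (λ _ → k) (codeOf k) (ev k)
  where
  codeOf : ℕ → Code n
  codeOf zero    = zeroF
  codeOf (suc k) = comp succF (codeOf k ∷ [])
  ev : ∀ k xs → Eval (codeOf k) xs k
  ev zero    xs = ev-zero
  ev (suc k) xs = ev-comp (ev-∷ (ev k xs) ev-[]) ev-succ

recFun : (Vec ℕ n → ℕ) → (Vec ℕ (2 + n) → ℕ) → Vec ℕ (1 + n) → ℕ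
recFun g h (zero  ∷ xs) = g xs
recFun g h (suc k ∷ xs) = h (k ∷ recFun g h (k ∷ xs) ∷ xs)

rec : Fn n → Fn (2 + n) → Fn (1 + n)
rec {n} g h = mkFn (recFun (fun g) (fun h)) (prec (code g) (code h)) ev
  where
  ev : ∀ xs → Eval (prec (code g) (code h)) xs (recFun (fun g) (fun h) xs)
  ev (zero  ∷ xs) = ev-prec-zero (eval g xs)
  ev (suc k ∷ xs) = ev-prec-suc (ev (k ∷ xs)) (eval h _)

-- Phrased to match the premises of `ev-mu`, which asks for an explicit positive value at each
-- smaller argument.
Least : (ℕ → ℕ) → ℕ → Set
Least p y = p y ≡ 0 × (∀ z → z < y → Σ ℕ λ k → p z ≡ suc k)

least : (p : ℕ → ℕ) → Σ ℕ (λ y → p y ≡ 0) → Σ ℕ (Least p)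
least p (y , py) with search (suc y)
  where
  search : ∀ N → (∀ z → z < N → Σ ℕ λ k → p z ≡ suc k) ⊎ Σ ℕ (Least p)
  search zero    = inj₁ λ _ ()
  search (suc N) with search N
  ... | inj₂ found = inj₂ found
  ... | inj₁ none with p N in eq
  ...   | zero  = inj₂ (N , eq , none)
  ...   | suc k = inj₁ λ z z<sN → case-≤ z (m≤n⇒m<n∨m≡n (≤-pred z<sN))
    where
    case-≤ : ∀ z → z < N ⊎ z ≡ N → Σ ℕ λ k → p z ≡ suc k
    case-≤ z (inj₁ z<N)  = none z z<N
    case-≤ z (inj₂ refl) = k , eq
... | inj₂ found = found
... | inj₁ none with none y ≤-refl
...   | k , eq = ⊥-elim (0≢1+n (trans (sym py) eq))

opaque
  minimise : (f : Fn (1 + n)) → (∀ xs → Σ ℕ λ y → fun f (y ∷ xs) ≡ 0) → Fn n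
  minimise f ex = mkFn (λ xs → proj₁ (leastOf xs)) (mu (code f)) λ xs →
    let y , py , below = leastOf xs in
    ev-mu (subst (Eval (code f) (y ∷ xs)) py (eval f _))
          (λ z z<y → let k , eq = below z z<y in
                     k , subst (Eval (code f) (z ∷ xs)) eq (eval f _))
    where
    leastOf : ∀ xs → Σ ℕ (Least (λ y → fun f (y ∷ xs)))
    leastOf xs = least _ (ex xs)

  minimise-least : (f : Fn (1 + n)) (ex : ∀ xs → Σ ℕ λ y → fun f (y ∷ xs) ≡ 0) →
    ∀ xs → Least (λ y → fun f (y ∷ xs)) (fun (minimise f ex) xs)
  minimise-least f ex xs = proj₂ (least _ (ex xs))

infixl 6 _+ᶠ_ _∸ᶠ_
infixl 7 _*ᶠ_

private
  predᶠ₁ : Fn 1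
  addᶠ subᶠ mulᶠ : Fn 2
  addᶠ = withFun (rec v0 (sucᶠ v1)) (λ xs → lookup xs zero + lookup xs (suc zero)) eq
    where
    eq : ∀ (xs : Vec ℕ 2) → _
    eq (zero  ∷ y ∷ []) = refl
    eq (suc x ∷ y ∷ []) = cong suc (eq (x ∷ y ∷ []))
  predᶠ₁ = withFun (rec (const 0) v0) (λ xs → pred (lookup xs zero)) eq
    where
    eq : ∀ (xs : Vec ℕ 1) → _
    eq (zero  ∷ []) = refl
    eq (suc x ∷ []) = refl
  subᶠ = withFun (rec v0 (predᶠ₁ ⟦ v1 ∷ [] ⟧)) (λ xs → lookup xs (suc zero) ∸ lookup xs zero) eq
    where
    eq : ∀ (xs : Vec ℕ 2) → _
    eq (zero  ∷ y ∷ []) = refl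
    eq (suc x ∷ y ∷ []) = trans (cong pred (eq (x ∷ y ∷ []))) (pred[m∸n]≡m∸[1+n] y x)
  mulᶠ = withFun (rec (const 0) (addᶠ ⟦ v2 ∷ v1 ∷ [] ⟧)) (λ xs → lookup xs zero * lookup xs (suc zero)) eq
    where
    eq : ∀ (xs : Vec ℕ 2) → _
    eq (zero  ∷ y ∷ []) = refl
    eq (suc x ∷ y ∷ []) = cong (y +_) (eq (x ∷ y ∷ []))

_+ᶠ_ _∸ᶠ_ _*ᶠ_ : Fn n → Fn n → Fn n
a +ᶠ b = addᶠ ⟦ a ∷ b ∷ [] ⟧
a ∸ᶠ b = subᶠ ⟦ b ∷ a ∷ [] ⟧
a *ᶠ b = mulᶠ ⟦ a ∷ b ∷ [] ⟧

predᶠ : Fn n → Fn n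
predᶠ a = predᶠ₁ ⟦ a ∷ [] ⟧

ifz : ℕ → ℕ → ℕ → ℕ
ifz zero    b c = b
ifz (suc _) b c = c

ifzᶠ : Fn n → Fn n → Fn n → Fn n
ifzᶠ a b c = sel ⟦ a ∷ b ∷ c ∷ [] ⟧
  where
  sel : Fn 3
  -- In the recursion step the arguments are the predecessor, the previous value, b and c, so `v3`
  -- is c.
  sel = withFun (rec v0 v3) (λ xs → ifz (lookup xs zero) (lookup xs (suc zero)) (lookup xs (suc (suc zero)))) eq
    where
    eq : ∀ (xs : Vec ℕ 3) → _
    eq (zero  ∷ b ∷ c ∷ []) = refl
    eq (suc x ∷ b ∷ c ∷ []) = refl

pick : ℕ → List ℕ → ℕ → ℕ
pick _       []       d = d
pick zero    (b ∷ bs) d = b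
pick (suc t) (b ∷ bs) d = pick t bs d

switch : Fn n → List (Fn n) → Fn n → Fn n
switch {n} t bs d = withFun (sw t bs) (λ xs → pick (fun t xs) (List.map (λ b → fun b xs) bs) (fun d xs)) (eq t bs)
  where
  sw : Fn n → List (Fn n) → Fn n
  sw t []       = d
  sw t (b ∷ bs) = ifzᶠ t b (sw (predᶠ t) bs)
  eq : ∀ t bs xs → fun (sw t bs) xs ≡ pick (fun t xs) (List.map (λ b → fun b xs) bs) (fun d xs)
  eq t []       xs = refl
  eq t (b ∷ bs) xs = trans (cong (ifz (fun t xs) (fun b xs)) (eq (predᶠ t) bs xs)) (ifz-pick (fun t xs))
    where
    ifz-pick : ∀ t {b bs d} → ifz t b (pick (pred t) bs d) ≡ pick t (b ∷ bs) d
    ifz-pick zero    = refl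
    ifz-pick (suc _) = refl

-- Zero stands for truth throughout: this expression is equality, a sum is a conjunction, a product
-- a disjunction, and `1 ∸_` negation.
eqᴺ : ℕ → ℕ → ℕ
eqᴺ x y = (x ∸ y) + (y ∸ x)

eqᶠ : Fn n → Fn n → Fn n
eqᶠ a b = (a ∸ᶠ b) +ᶠ (b ∸ᶠ a)

eqᴺ-sound : ∀ x y → eqᴺ x y ≡ 0 → x ≡ y
eqᴺ-sound x y e = ≤-antisym (m∸n≡0⇒m≤n (m+n≡0⇒m≡0 (x ∸ y) e)) (m∸n≡0⇒m≤n (m+n≡0⇒n≡0 (x ∸ y) e))

eqᴺ-refl : ∀ x → eqᴺ x x ≡ 0
eqᴺ-refl x = cong₂ _+_ (n∸n≡0 x) (n∸n≡0 x)

-- Skips the accumulator, which is the second argument of the step function of a primitive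
-- recursion.
weaken₁ : Fn (1 + n) → Fn (2 + n)
weaken₁ {n} f = withFun (f ⟦ v0 ∷ tabulate (λ i → var (suc (suc i))) ⟧) drop₁ eq
  where
  drop₁ : Vec ℕ (2 + n) → ℕ
  drop₁ (y ∷ u ∷ xs) = fun f (y ∷ xs)
  eq : ∀ xs → _
  eq (y ∷ u ∷ xs) = cong (λ zs → fun f (y ∷ zs))
    (trans (sym (tabulate-∘ (λ g → fun g (y ∷ u ∷ xs)) (λ i → var (suc (suc i))))) (tabulate∘lookup xs))

∸-zero : ∀ {a} → 1 ∸ a ≡ 0 → a ≢ 0
∸-zero {suc a} _ ()

≢0⇒∸ : ∀ {a} → a ≢ 0 → 1 ∸ a ≡ 0
≢0⇒∸ {zero}  a≢0 = ⊥-elim (a≢0 refl)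
≢0⇒∸ {suc a} _   = 0∸n≡0 a

sum< : ℕ → (ℕ → ℕ) → ℕ
sum< zero    p = 0
sum< (suc k) p = p k + sum< k p

-- Its vanishing expresses bounded existential quantification.
prod< : ℕ → (ℕ → ℕ) → ℕ
prod< zero    p = 1
prod< (suc k) p = p k * prod< k p

sumᶠ prodᶠ : Fn (1 + n) → Fn (1 + n)
sumᶠ {n} f = withFun (rec (const 0) (weaken₁ f +ᶠ v1)) F eq
  where
  F : Vec ℕ (1 + n) → ℕ
  F (k ∷ xs) = sum< k (λ i → fun f (i ∷ xs))
  eq : ∀ xs → _ ≡ F xs
  eq (zero  ∷ xs) = refl
  eq (suc k ∷ xs) = cong (fun f (k ∷ xs) +_) (eq (k ∷ xs))
prodᶠ {n} f = withFun (rec (const 1) (weaken₁ f *ᶠ v1)) F eq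
  where
  F : Vec ℕ (1 + n) → ℕ
  F (k ∷ xs) = prod< k (λ i → fun f (i ∷ xs))
  eq : ∀ xs → _ ≡ F xs
  eq (zero  ∷ xs) = refl
  eq (suc k ∷ xs) = cong (fun f (k ∷ xs) *_) (eq (k ∷ xs))

prod<-sound : ∀ k p → prod< k p ≡ 0 → Σ ℕ λ i → i < k × p i ≡ 0
prod<-sound (suc k) p e with m*n≡0⇒m≡0∨n≡0 (p k) e
... | inj₁ pk = k , ≤-refl , pk
... | inj₂ rest = let i , i<k , pi = prod<-sound k p rest in i , m≤n⇒m≤1+n i<k , pi

prod<-complete : ∀ k p i → i < k → p i ≡ 0 → prod< k p ≡ 0
prod<-complete (suc k) p i i<sk pi with m≤n⇒m<n∨m≡n (≤-pred i<sk)
... | inj₂ refl rewrite pi = refl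
... | inj₁ i<k = trans (cong (p k *_) (prod<-complete k p i i<k pi)) (*-zeroʳ (p k))

≤-sum< : ∀ k p i → i < k → p i ≤ sum< k p
≤-sum< (suc k) p i i<sk with m≤n⇒m<n∨m≡n (≤-pred i<sk)
... | inj₂ refl = m≤m+n _ _
... | inj₁ i<k = ≤-trans (≤-sum< k p i i<k) (m≤n+m _ (p k))

-- Cantor pairing.

private
  tri : ℕ → ℕ
  tri zero    = 0
  tri (suc k) = tri k + suc k

  triᶠ : Fn 1
  triᶠ = withFun (rec (const 0) (v1 +ᶠ sucᶠ v0)) (λ xs → tri (lookup xs zero)) eq
    where
    eq : ∀ (xs : Vec ℕ 1) → _
    eq (zero  ∷ []) = refl
    eq (suc k ∷ []) = cong (_+ suc k) (eq (k ∷ []))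

  -- The largest r with `tri r ≤ n`, that is, the diagonal on which the pair with code n lies.
  root : ℕ → ℕ
  root zero    = 0
  root (suc n) = ifz (tri (suc (root n)) ∸ suc n) (suc (root n)) (root n)

  rootᶠ : Fn 1
  rootᶠ = withFun
    (rec (const 0) (ifzᶠ ((triᶠ ⟦ sucᶠ v1 ∷ [] ⟧) ∸ᶠ sucᶠ v0) (sucᶠ v1) v1))
    (λ xs → root (lookup xs zero)) eq
    where
    eq : ∀ (xs : Vec ℕ 1) → _
    eq (zero  ∷ []) = refl
    eq (suc k ∷ []) = cong (λ r → ifz (tri (suc r) ∸ suc k) (suc r) r) (eq (k ∷ []))

  root-spec : ∀ n → tri (root n) ≤ n × n < tri (suc (root n))
  root-spec zero = z≤n , s≤s z≤n
  root-spec (suc n) with root-spec n | tri (suc (root n)) ∸ suc n in e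
  ... | lo , hi | zero  = m∸n≡0⇒m≤n e , (begin-strict
      suc n                                  ≤⟨ hi ⟩
      tri (suc (root n))                     <⟨ m<m+n _ (s≤s z≤n) ⟩
      tri (suc (root n)) + suc (suc (root n)) ∎)
    where open ≤-Reasoning
  ... | lo , hi | suc d = m≤n⇒m≤1+n lo , m∸n≢0⇒n<m (λ z → 0≢1+n (trans (sym z) e))

  tri-mono : ∀ {j k} → j ≤ k → tri j ≤ tri k
  tri-mono {zero}  _ = z≤n
  tri-mono {suc j} (s≤s j≤k) = +-mono-≤ (tri-mono j≤k) (s≤s j≤k)

  root-unique : ∀ k n → tri k ≤ n → n < tri (suc k) → root n ≡ k
  root-unique k n lo hi with root-spec n
  ... | lo′ , hi′ = ≤-antisym
    (≮⇒≥ λ k<r → <-irrefl refl (<-≤-trans hi (≤-trans (tri-mono k<r) lo′)))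
    (≮⇒≥ λ r<k → <-irrefl refl (<-≤-trans hi′ (≤-trans (tri-mono r<k) lo)))

opaque
  ⟨_,_⟩ : ℕ → ℕ → ℕ
  ⟨ x , y ⟩ = tri (x + y) + y

  fst snd : ℕ → ℕ
  snd p = p ∸ tri (root p)
  fst p = root p ∸ snd p

  private
    root-pair : ∀ x y → root ⟨ x , y ⟩ ≡ x + y
    root-pair x y = root-unique (x + y) _ (m≤m+n _ y) (+-monoʳ-< (tri (x + y)) (s≤s (m≤n+m y x)))

  snd-pair : ∀ x y → snd ⟨ x , y ⟩ ≡ y
  snd-pair x y rewrite root-pair x y = m+n∸m≡n (tri (x + y)) y

  fst-pair : ∀ x y → fst ⟨ x , y ⟩ ≡ x
  fst-pair x y rewrite snd-pair x y | root-pair x y = m+n∸n≡m x y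

  pair-surj : ∀ p → ⟨ fst p , snd p ⟩ ≡ p
  pair-surj p with root-spec p
  ... | lo , hi = begin
    tri (root p ∸ snd p + snd p) + snd p ≡⟨ cong (λ r → tri r + snd p) (m∸n+n≡m snd≤root) ⟩
    tri (root p) + snd p                 ≡⟨ m+[n∸m]≡n lo ⟩
    p                                    ∎
    where
    open ≡-Reasoning
    snd≤root : snd p ≤ root p
    snd≤root = ≤-pred (+-cancelˡ-< (tri (root p)) _ _ (subst (_< tri (suc (root p))) (sym (m+[n∸m]≡n lo)) hi))

  fst≤ : ∀ x y → x ≤ ⟨ x , y ⟩
  fst≤ x y = ≤-trans (m≤m+n x y) (≤-trans (n≤tri (x + y)) (m≤m+n _ y))
    where
    n≤tri : ∀ n → n ≤ tri n
    n≤tri zero    = z≤n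
    n≤tri (suc n) = m≤n+m (suc n) (tri n)

  snd≤ : ∀ x y → y ≤ ⟨ x , y ⟩
  snd≤ x y = m≤n+m y _

  private
    -- Only a code and its correctness are made where the pairing unfolds; the function of `pairᶠ`
    -- is then the opaque `⟨_,_⟩` itself.
    pairᶠ₂ : Σ (Code 2) λ c → ∀ xs → Eval c xs ⟨ lookup xs zero , lookup xs (suc zero) ⟩
    pairᶠ₂ = code f , eval f
      where
      f : Fn 2
      f = triᶠ ⟦ v0 +ᶠ v1 ∷ [] ⟧ +ᶠ v1
    sndᶠ₁ : Σ (Code 1) λ c → ∀ xs → Eval c xs (snd (lookup xs zero))
    sndᶠ₁ = code f , eval f
      where
      f : Fn 1
      f = v0 ∸ᶠ triᶠ ⟦ rootᶠ ∷ [] ⟧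
    fstᶠ₁ : Σ (Code 1) λ c → ∀ xs → Eval c xs (fst (lookup xs zero))
    fstᶠ₁ = code f , eval f
      where
      f : Fn 1
      f = rootᶠ ∸ᶠ (v0 ∸ᶠ triᶠ ⟦ rootᶠ ∷ [] ⟧)

pairᶠ : Fn n → Fn n → Fn n
pairᶠ a b = mkFn (λ xs → ⟨ lookup xs zero , lookup xs (suc zero) ⟩) (proj₁ pairᶠ₂) (proj₂ pairᶠ₂) ⟦ a ∷ b ∷ [] ⟧

fstᶠ sndᶠ : Fn n → Fn n
fstᶠ a = mkFn (λ xs → fst (lookup xs zero)) (proj₁ fstᶠ₁) (proj₂ fstᶠ₁) ⟦ a ∷ [] ⟧
sndᶠ a = mkFn (λ xs → snd (lookup xs zero)) (proj₁ sndᶠ₁) (proj₂ sndᶠ₁) ⟦ a ∷ [] ⟧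

pair-inj : ∀ {x y x′ y′} → ⟨ x , y ⟩ ≡ ⟨ x′ , y′ ⟩ → x ≡ x′ × y ≡ y′
pair-inj {x} {y} {x′} {y′} e =
  trans (sym (fst-pair x y)) (trans (cong fst e) (fst-pair x′ y′)) ,
  trans (sym (snd-pair x y)) (trans (cong snd e) (snd-pair x′ y′))

-- A noncomputable settling time

-- The universal machine: `evS c xs k` evaluates the program c on the arguments xs
-- and passes the result to the continuation stack k; `retS v k` returns v to k.
-- A continuation is ⟨ tag , ⟨ a , ⟨ b , ⟨ c , rest ⟩ ⟩ ⟩ ⟩, a program ⟨ tag , ⟨ a , b ⟩ ⟩.
evS : ℕ → ℕ → ℕ → ℕ
evS c xs k = ⟨ 0 , ⟨ c , ⟨ xs , k ⟩ ⟩ ⟩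

retS : ℕ → ℕ → ℕ
retS v k = ⟨ 1 , ⟨ v , ⟨ 0 , k ⟩ ⟩ ⟩

dead : ℕ
dead = ⟨ 2 , 0 ⟩

prog : ℕ → ℕ → ℕ → ℕ
prog t a b = ⟨ t , ⟨ a , b ⟩ ⟩

kont : ℕ → ℕ → ℕ → ℕ → ℕ → ℕ
kont t a b c k = ⟨ t , ⟨ a , ⟨ b , ⟨ c , k ⟩ ⟩ ⟩ ⟩

halt : ℕ
halt = kont 0 0 0 0 0

private
  evSᶠ : Fn n → Fn n → Fn n → Fn n
  evSᶠ c xs k = pairᶠ (const 0) (pairᶠ c (pairᶠ xs k))

  retSᶠ : Fn n → Fn n → Fn n
  retSᶠ v k = pairᶠ (const 1) (pairᶠ v (pairᶠ (const 0) k))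

  progᶠ : Fn n → Fn n → Fn n → Fn n
  progᶠ t a b = pairᶠ t (pairᶠ a b)

  kontᶠ : Fn n → Fn n → Fn n → Fn n → Fn n → Fn n
  kontᶠ t a b c k = pairᶠ t (pairᶠ a (pairᶠ b (pairᶠ c k)))

-- The branches for program tags 0 to 7: zero (also the empty program list, as 0 codes the empty
-- vector), successor, first projection, projection past the first argument, nonempty program list,
-- composition, primitive recursion, minimisation.
evalStepᶠ : Fn 5
evalStepᶠ = switch t
  ( retSᶠ (const 0) k
  ∷ retSᶠ (sucᶠ (fstᶠ xs)) k
  ∷ retSᶠ (fstᶠ xs) k
  ∷ evSᶠ a (sndᶠ xs) k
  ∷ evSᶠ a xs (kontᶠ (const 1) b xs (const 0) k)
  ∷ evSᶠ b xs (kontᶠ (const 3) a (const 0) (const 0) k)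
  ∷ ifzᶠ (fstᶠ xs)
      (evSᶠ a (sndᶠ xs) k)
      (evSᶠ (progᶠ t a b) (pairᶠ (predᶠ (fstᶠ xs)) (sndᶠ xs))
        (kontᶠ (const 4) b (predᶠ (fstᶠ xs)) (sndᶠ xs) k))
  ∷ evSᶠ a (pairᶠ (const 0) xs) (kontᶠ (const 5) a (const 0) xs k)
  ∷ []) (const dead)
  where
  t a b xs k : Fn 5
  t = v0
  a = v1
  b = v2
  xs = v3
  k = v4

-- The branches for continuation tags 0 to 5: stop; head of a program list evaluated, go on to its
-- tail; tail evaluated, prepend the head; arguments evaluated, call the outer program; recursive
-- value known, call the recursion step; minimisation test, answer or try the next candidate.
retStepᶠ : Fn 6
retStepᶠ = switch t
  ( const dead
  ∷ evSᶠ a b (kontᶠ (const 2) v (const 0) (const 0) k)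
  ∷ retSᶠ (pairᶠ a v) k
  ∷ evSᶠ a v k
  ∷ evSᶠ a (pairᶠ b (pairᶠ v c)) k
  ∷ ifzᶠ v (retSᶠ b k)
      (evSᶠ a (pairᶠ (sucᶠ b) c) (kontᶠ (const 5) a (sucᶠ b) c k))
  ∷ []) (const dead)
  where
  t a b c k v : Fn 6
  t = v0
  a = v1
  b = v2
  c = v3
  k = v4
  v = var (suc (suc (suc (suc (suc zero)))))

-- Both kinds of state store their data in the same places: `c` is the program to evaluate or the
-- value returned.
stepᶠ : Fn 1
stepᶠ = switch (fstᶠ s)
  ( evalStepᶠ ⟦ fstᶠ c ∷ fstᶠ (sndᶠ c) ∷ sndᶠ (sndᶠ c) ∷ xs ∷ k ∷ [] ⟧
  ∷ retStepᶠ ⟦ fstᶠ k ∷ fstᶠ (sndᶠ k) ∷ fstᶠ (sndᶠ (sndᶠ k)) ∷ fstᶠ (sndᶠ (sndᶠ (sndᶠ k)))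
               ∷ sndᶠ (sndᶠ (sndᶠ (sndᶠ k))) ∷ c ∷ [] ⟧
  ∷ []) (const dead)
  where
  s c xs k : Fn 1
  s  = v0
  c  = fstᶠ (sndᶠ s)
  xs = fstᶠ (sndᶠ (sndᶠ s))
  k  = sndᶠ (sndᶠ (sndᶠ s))

step : ℕ → ℕ
step = app₁ stepᶠ

private
  step-ev : ∀ t a b xs k →
    step (evS (prog t a b) xs k) ≡ fun evalStepᶠ (t ∷ a ∷ b ∷ xs ∷ k ∷ [])
  step-ev t a b xs k
    rewrite fst-pair 0 ⟨ prog t a b , ⟨ xs , k ⟩ ⟩
          | snd-pair 0 ⟨ prog t a b , ⟨ xs , k ⟩ ⟩
          | fst-pair (prog t a b) ⟨ xs , k ⟩
          | snd-pair (prog t a b) ⟨ xs , k ⟩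
          | fst-pair xs k | snd-pair xs k
          | fst-pair t ⟨ a , b ⟩ | snd-pair t ⟨ a , b ⟩
          | fst-pair a b | snd-pair a b = refl

  step-ret : ∀ t a b c k v →
    step (retS v (kont t a b c k)) ≡ fun retStepᶠ (t ∷ a ∷ b ∷ c ∷ k ∷ v ∷ [])
  step-ret t a b c k v
    rewrite fst-pair 1 ⟨ v , ⟨ 0 , kont t a b c k ⟩ ⟩
          | snd-pair 1 ⟨ v , ⟨ 0 , kont t a b c k ⟩ ⟩
          | fst-pair v ⟨ 0 , kont t a b c k ⟩
          | snd-pair v ⟨ 0 , kont t a b c k ⟩
          | snd-pair 0 (kont t a b c k)
          | fst-pair t ⟨ a , ⟨ b , ⟨ c , k ⟩ ⟩ ⟩ | snd-pair t ⟨ a , ⟨ b , ⟨ c , k ⟩ ⟩ ⟩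
          | fst-pair a ⟨ b , ⟨ c , k ⟩ ⟩ | snd-pair a ⟨ b , ⟨ c , k ⟩ ⟩
          | fst-pair b ⟨ c , k ⟩ | snd-pair b ⟨ c , k ⟩
          | fst-pair c k | snd-pair c k = refl

  step-dead : step dead ≡ dead
  step-dead rewrite fst-pair 2 0 = refl

mutual
  ⌜_⌝ : Code n → ℕ
  ⌜ zeroF ⌝      = prog 0 0 0
  ⌜ succF ⌝      = prog 1 0 0
  ⌜ proj i ⌝     = ⌜proj⌝ i
  ⌜ comp f gs ⌝  = prog 5 ⌜ f ⌝ ⌜ gs ⌝*
  ⌜ prec g h ⌝   = prog 6 ⌜ g ⌝ ⌜ h ⌝
  ⌜ mu f ⌝       = prog 7 ⌜ f ⌝ 0

  ⌜proj⌝ : Fin n → ℕ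
  ⌜proj⌝ zero    = prog 2 0 0
  ⌜proj⌝ (suc i) = prog 3 (⌜proj⌝ i) 0

  ⌜_⌝* : Vec (Code n) m → ℕ
  ⌜ [] ⌝*     = prog 0 0 0
  ⌜ g ∷ gs ⌝* = prog 4 ⌜ g ⌝ ⌜ gs ⌝*

args : Vec ℕ n → ℕ
args []       = 0
args (x ∷ xs) = ⟨ x , args xs ⟩

infix 4 _⟶*_
infixr 5 _then_
data _⟶*_ : ℕ → ℕ → Set where
  done   : ∀ {s} → s ⟶* s
  _then_ : ∀ {s s₁ s₂} → step s ≡ s₁ → s₁ ⟶* s₂ → s ⟶* s₂

infixr 5 _⨾_
_⨾_ : ∀ {s s₁ s₂} → s ⟶* s₁ → s₁ ⟶* s₂ → s ⟶* s₂
done       ⨾ q = q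
(e then p) ⨾ q = e then (p ⨾ q)

run-proj : (i : Fin n) (xs : Vec ℕ n) (k : ℕ) → evS (⌜proj⌝ i) (args xs) k ⟶* retS (lookup xs i) k
run-proj zero (x ∷ xs) k =
  trans (step-ev 2 0 0 _ k) (cong (λ y → retS y k) (fst-pair x (args xs))) then done
run-proj (suc i) (x ∷ xs) k =
  trans (step-ev 3 (⌜proj⌝ i) 0 _ k) (cong (λ y → evS (⌜proj⌝ i) y k) (snd-pair x (args xs)))
  then run-proj i xs k

mutual
  -- By induction on the evaluation. The continuation is arbitrary because subprograms run on top of
  -- a longer stack.
  simulate : {c : Code n} {xs : Vec ℕ n} {v : ℕ} → Eval c xs v → ∀ k →
    evS ⌜ c ⌝ (args xs) k ⟶* retS v k
  simulate ev-zero k = step-ev 0 0 0 _ k then done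
  simulate (ev-succ {x}) k =
    trans (step-ev 1 0 0 _ k) (cong (λ y → retS (suc y) k) (fst-pair x 0)) then done
  simulate (ev-proj {i = i} {xs}) k = run-proj i xs k
  simulate (ev-comp {f = f} {gs} es e) k =
    step-ev 5 ⌜ f ⌝ ⌜ gs ⌝* _ k then
    simulate* es (kont 3 ⌜ f ⌝ 0 0 k) ⨾
    step-ret 3 ⌜ f ⌝ 0 0 k _ then
    simulate e k
  simulate (ev-prec-zero {g = g} {h} {xs} e) k =
    trans (step-ev 6 ⌜ g ⌝ ⌜ h ⌝ _ k) prec-zero then simulate e k
    where
    prec-zero : fun evalStepᶠ (6 ∷ ⌜ g ⌝ ∷ ⌜ h ⌝ ∷ ⟨ 0 , args xs ⟩ ∷ k ∷ []) ≡ evS ⌜ g ⌝ (args xs) k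
    prec-zero rewrite fst-pair 0 (args xs) | snd-pair 0 (args xs) = refl
  simulate (ev-prec-suc {g = g} {h} {xs} {y} e e′) k =
    trans (step-ev 6 ⌜ g ⌝ ⌜ h ⌝ _ k) prec-suc then
    simulate e (kont 4 ⌜ h ⌝ y (args xs) k) ⨾
    step-ret 4 ⌜ h ⌝ y (args xs) k _ then
    simulate e′ k
    where
    prec-suc : fun evalStepᶠ (6 ∷ ⌜ g ⌝ ∷ ⌜ h ⌝ ∷ ⟨ suc y , args xs ⟩ ∷ k ∷ [])
      ≡ evS ⌜ prec g h ⌝ ⟨ y , args xs ⟩ (kont 4 ⌜ h ⌝ y (args xs) k)
    prec-suc rewrite fst-pair (suc y) (args xs) | snd-pair (suc y) (args xs) = refl
  simulate (ev-mu {f = f} {xs} {y} e below) k =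
    step-ev 7 ⌜ f ⌝ 0 _ k then
    -- `climb` runs through the failing tests below y, by recursion on the distance that remains.
    climb y 0 (+-identityʳ y) ⨾
    simulate e (kont 5 ⌜ f ⌝ y (args xs) k) ⨾
    step-ret 5 ⌜ f ⌝ y (args xs) k 0 then
    done
    where
    at : ℕ → ℕ
    at z = evS ⌜ f ⌝ ⟨ z , args xs ⟩ (kont 5 ⌜ f ⌝ z (args xs) k)
    climb : ∀ d z → d + z ≡ y → at z ⟶* at y
    climb zero    z refl = done
    climb (suc d) z e′ with below z (subst (z <_) e′ (m<n+m z (s≤s z≤n)))
    ... | u , ev =
      simulate ev (kont 5 ⌜ f ⌝ z (args xs) k) ⨾
      step-ret 5 ⌜ f ⌝ z (args xs) k (suc u) then
      climb d (suc z) (trans (+-suc d z) e′)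

  simulate* : {gs : Vec (Code n) m} {xs : Vec ℕ n} {ys : Vec ℕ m} → EvalAll gs xs ys → ∀ k →
    evS ⌜ gs ⌝* (args xs) k ⟶* retS (args ys) k
  simulate* ev-[] k = step-ev 0 0 0 _ k then done
  simulate* (ev-∷ {g = g} {gs} {xs} {y} e es) k =
    step-ev 4 ⌜ g ⌝ ⌜ gs ⌝* (args xs) k then
    simulate e (kont 1 ⌜ gs ⌝* (args xs) 0 k) ⨾
    step-ret 1 ⌜ gs ⌝* (args xs) 0 k y then
    simulate* es (kont 2 y 0 0 k) ⨾
    step-ret 2 y 0 0 k _ then
    done

-- The argument vector `⟨ e , 0 ⟩` has e as its only entry: the program is applied to its own index.
run : ℕ → ℕ → ℕ
run e zero    = evS e ⟨ e , 0 ⟩ halt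
run e (suc t) = step (run e t)

runᶠ : Fn 2
runᶠ = withFun (rec (evSᶠ v0 (pairᶠ v0 (const 0)) (const halt)) (stepᶠ ⟦ v1 ∷ [] ⟧))
               (λ { (t ∷ e ∷ []) → run e t }) eq
  where
  eq : ∀ (xs : Vec ℕ 2) → _
  eq (zero  ∷ e ∷ []) = refl
  eq (suc t ∷ e ∷ []) = cong step (eq (t ∷ e ∷ []))

-- Zero iff program e, run on e, returns 0 after exactly t steps.
returns-0 : ℕ → ℕ → ℕ
returns-0 e t = eqᴺ (run e t) (retS 0 halt)

returns-0ᶠ : Fn 2
returns-0ᶠ = eqᶠ (runᶠ ⟦ v1 ∷ v0 ∷ [] ⟧) (const (retS 0 halt))

run-⟶* : ∀ {e s} t → run e t ⟶* s → Σ ℕ λ t′ → run e t′ ≡ s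
run-⟶* t done          = t , refl
run-⟶* t (refl then p) = run-⟶* (suc t) p

private
  -- A return to the empty stack is followed by `dead` for ever, whence the time and the value of a
  -- return are unique.
  after-ret : ∀ e t v d → run e t ≡ retS v halt → run e (suc d + t) ≡ dead
  after-ret e t v zero    eq = trans (cong step eq) (step-ret 0 0 0 0 0 v)
  after-ret e t v (suc d) eq = trans (cong step (after-ret e t v d eq)) step-dead

  dead≢ret : ∀ v → dead ≢ retS v halt
  dead≢ret v e with proj₁ (pair-inj e)
  ... | ()

  ret-not-later : ∀ {e t v t′ v′} → run e t ≡ retS v halt → run e t′ ≡ retS v′ halt → ¬ t < t′
  ret-not-later {e} {t} {v} {t′} {v′} eq eq′ t<t′ = dead≢ret v′ (begin
    dead                     ≡⟨ sym (after-ret e t v d eq) ⟩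
    run e (suc d + t)        ≡⟨ cong (run e) (trans (sym (+-suc d t)) (m∸n+n≡m t<t′)) ⟩
    run e t′                 ≡⟨ eq′ ⟩
    retS v′ halt             ∎)
    where
    open ≡-Reasoning
    d : ℕ
    d = t′ ∸ suc t

ret-unique : ∀ {e t v t′ v′} → run e t ≡ retS v halt → run e t′ ≡ retS v′ halt → t ≡ t′ × v ≡ v′
ret-unique {e} {t} {v} {t′} {v′} eq eq′ =
  t≡t′ , proj₁ (pair-inj (proj₂ (pair-inj (trans (sym eq) (trans (cong (run e) t≡t′) eq′)))))
  where
  t≡t′ : t ≡ t′
  t≡t′ = ≤-antisym (≮⇒≥ (ret-not-later {e} eq′ eq)) (≮⇒≥ (ret-not-later {e} eq eq′))

self-application : (f : Fn 1) → Σ ℕ λ e → Σ ℕ λ t → run e t ≡ retS (app₁ f e) halt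
self-application f = ⌜ code f ⌝ , run-⟶* 0 (simulate (eval f (⌜ code f ⌝ ∷ [])) halt)

private
  -- Answers 1 if program e, run on e, returns 0 within `app₁ b e` steps, and 0 otherwise. If b is a
  -- bound, this differs from the answer of e.
  decᶠ : Fn 1 → Fn 1
  decᶠ b = ifzᶠ (prodᶠ (returns-0ᶠ ⟦ v1 ∷ v0 ∷ [] ⟧) ⟦ sucᶠ b ∷ v0 ∷ [] ⟧) (const 1) (const 0)

  decᶠ-fun : ∀ b e → app₁ (decᶠ b) e ≡ ifz (prod< (suc (app₁ b e)) (returns-0 e)) 1 0
  decᶠ-fun b e = refl

-- A computable bound would decide whether program e returns 0 on e; running
-- the decider on its own index is contradictory.
halting-time-unbounded : (b : Fn 1) → ¬ (∀ e t → returns-0 e t ≡ 0 → t ≤ app₁ b e)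
halting-time-unbounded b bound = contradictory (self-application (decᶠ b))
  where
  contradictory : (Σ ℕ λ e → Σ ℕ λ t → run e t ≡ retS (app₁ (decᶠ b) e) halt) → ⊥
  contradictory (d , t , r) = by-value _ refl (trans r (cong (λ v → retS v halt) (decᶠ-fun b d)))
    where
    by-value : ∀ p → prod< (suc (app₁ b d)) (returns-0 d) ≡ p → run d t ≡ retS (ifz p 1 0) halt → ⊥
    by-value zero π≡0 r =
      let i , _ , h = prod<-sound (suc (app₁ b d)) (returns-0 d) π≡0 in
      1+n≢0 (proj₂ (ret-unique {d} {t} {1} {i} {0} r (eqᴺ-sound (run d i) (retS 0 halt) h)))
    by-value (suc k) π≡suc r = 1+n≢0 (trans (sym π≡suc)
      (prod<-complete (suc (app₁ b d)) (returns-0 d) t (s≤s (bound d t h)) h))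
      where
      h : returns-0 d t ≡ 0
      h = trans (cong (λ z → eqᴺ z (retS 0 halt)) r) (eqᴺ-refl (retS 0 halt))

opaque
  -- From here on the halting problem enters only as a computable relation whose settling times are
  -- unique but have no computable bound.
  settlesᶠ : Fn 2
  settlesᶠ = returns-0ᶠ

  settles-unique : ∀ {e t t′} → app₂ settlesᶠ e t ≡ 0 → app₂ settlesᶠ e t′ ≡ 0 → t ≡ t′
  settles-unique {e} {t} {t′} h h′ =
    proj₁ (ret-unique {e} (eqᴺ-sound (run e t) (retS 0 halt) h) (eqᴺ-sound (run e t′) (retS 0 halt) h′))

  settling-time-unbounded : (b : Fn 1) → ¬ (∀ e t → app₂ settlesᶠ e t ≡ 0 → t ≤ app₁ b e)
  settling-time-unbounded = halting-time-unbounded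

-- Counting

-- Predicates on ℕ are functions whose zeros are the elements.
Pred : Set
Pred = ℕ → ℕ

count : Pred → ℕ → ℕ
count p N = sum< N (λ i → 1 ∸ p i)

count-in : ∀ p N → p N ≡ 0 → count p (suc N) ≡ suc (count p N)
count-in p N pN rewrite pN = refl

count-mono : ∀ p {M N} → M ≤ N → count p M ≤ count p N
count-mono p {M} {N} M≤N = go (≤⇒≤′ M≤N)
  where
  go : ∀ {N} → M ≤′ N → count p M ≤ count p N
  go (≤′-reflexive refl) = ≤-refl
  go (≤′-step {N} M≤′N) = ≤-trans (go M≤′N) (m≤n+m (count p N) (1 ∸ p N))

count-< : ∀ p {M N} → p M ≡ 0 → M < N → count p M < count p N
count-< p {M} {N} pM M<N = subst (_≤ count p N) (count-in p M pM) (count-mono p M<N)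

count-≤ : ∀ p N → count p N ≤ N
count-≤ p zero    = z≤n
count-≤ p (suc N) = +-mono-≤ (m∸n≤m 1 (p N)) (count-≤ p N)

count-all : ∀ p N → (∀ u → u < N → p u ≡ 0) → count p N ≡ N
count-all p zero    all = refl
count-all p (suc N) all rewrite all N ≤-refl = cong suc (count-all p N (λ u u<N → all u (m≤n⇒m≤1+n u<N)))

count-cong : ∀ p q N → (∀ u → u < N → p u ≡ 0 → q u ≡ 0) → (∀ u → u < N → q u ≡ 0 → p u ≡ 0) →
  count p N ≡ count q N
count-cong p q zero    f g = refl
count-cong p q (suc N) f g = cong₂ _+_ here≡
  (count-cong p q N (λ u u<N → f u (m≤n⇒m≤1+n u<N)) (λ u u<N → g u (m≤n⇒m≤1+n u<N)))
  where
  here≡ : 1 ∸ p N ≡ 1 ∸ q N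
  here≡ with p N | q N | f N ≤-refl | g N ≤-refl
  ... | zero  | zero  | _  | _  = refl
  ... | zero  | suc b | f′ | _  with f′ refl
  ...   | ()
  here≡ | suc a | zero  | _  | g′ with g′ refl
  ...   | ()
  here≡ | suc a | suc b | _  | _  = trans (0∸n≡0 a) (sym (0∸n≡0 b))

nth : ∀ p N n → n < count p N → Σ ℕ λ t → p t ≡ 0 × count p t ≡ n
nth p (suc N) n n<c with n <? count p N
... | yes n<c′ = nth p N n n<c′
... | no n≮c′ with p N in eq
...   | zero  = N , eq , ≤-antisym (≮⇒≥ n≮c′) (≤-pred n<c)
...   | suc k = ⊥-elim (n≮c′ (subst (λ z → n < z + count p N) (0∸n≡0 k) n<c))

_∖_ : Pred → ℕ → Pred
(p ∖ q) u = p u + (1 ∸ eqᴺ u q)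

∖-keep : ∀ p q u → p u ≡ 0 → u ≢ q → (p ∖ q) u ≡ 0
∖-keep p q u pu u≢q rewrite pu with eqᴺ u q in e
... | zero  = ⊥-elim (u≢q (eqᴺ-sound u q e))
... | suc k = 0∸n≡0 k

∖-⊆ : ∀ p q u → (p ∖ q) u ≡ 0 → p u ≡ 0
∖-⊆ p q u e = m+n≡0⇒m≡0 (p u) e

∖-self : ∀ p q → (p ∖ q) q ≢ 0
∖-self p q e = 1+n≢0 (trans (sym (cong (1 ∸_) (eqᴺ-refl q))) (m+n≡0⇒n≡0 (p q) e))

count-∖-≥ : ∀ p q N → N ≤ q → count (p ∖ q) N ≡ count p N
count-∖-≥ p q N N≤q = count-cong (p ∖ q) p N (λ u _ → ∖-⊆ p q u)
  (λ u u<N pu → ∖-keep p q u pu (<⇒≢ (<-≤-trans u<N N≤q)))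

count-∖ : ∀ p q N → p q ≡ 0 → q < N → count p N ≡ suc (count (p ∖ q) N)
count-∖ p q (suc N) pq q<sN with m≤n⇒m<n∨m≡n (≤-pred q<sN)
... | inj₁ q<N = begin
  (1 ∸ p N) + count p N                     ≡⟨ cong₂ _+_ same (count-∖ p q N pq q<N) ⟩
  (1 ∸ (p ∖ q) N) + suc (count (p ∖ q) N)   ≡⟨ +-suc _ _ ⟩
  suc ((1 ∸ (p ∖ q) N) + count (p ∖ q) N)   ∎
  where
  open ≡-Reasoning
  same : 1 ∸ p N ≡ 1 ∸ (p ∖ q) N
  same with p N in pN
  ... | suc k = trans (0∸n≡0 k) (sym (0∸n≡0 (k + (1 ∸ eqᴺ N q))))
  ... | zero with eqᴺ N q in e
  ...   | zero  = ⊥-elim (<⇒≢ q<N (sym (eqᴺ-sound N q e)))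
  ...   | suc k = cong (1 ∸_) (sym (0∸n≡0 k))
... | inj₂ refl = begin
  (1 ∸ p q) + count p q                     ≡⟨ cong (λ z → (1 ∸ z) + count p q) pq ⟩
  suc (count p q)                           ≡⟨ cong suc (sym (count-∖-≥ p q q ≤-refl)) ⟩
  suc (count (p ∖ q) q)                     ≡⟨ cong (λ z → suc (z + count (p ∖ q) q)) (sym removed) ⟩
  suc ((1 ∸ (p ∖ q) q) + count (p ∖ q) q)   ∎
  where
  open ≡-Reasoning
  removed : 1 ∸ (p ∖ q) q ≡ 0
  removed with (p ∖ q) q in e
  ... | zero  = ⊥-elim (∖-self p q e)
  ... | suc k = 0∸n≡0 k

count-∖-≤ : ∀ p q N → count p N ≤ suc (count (p ∖ q) N)
count-∖-≤ p q N with p q ≟ 0 | q <? N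
... | yes pq | yes q<N = ≤-reflexive (count-∖ p q N pq q<N)
... | yes pq | no q≮N  = m≤n⇒m≤1+n (≤-reflexive (sym (count-∖-≥ p q N (≮⇒≥ q≮N))))
... | no ¬pq | _       = m≤n⇒m≤1+n (≤-reflexive (count-cong p (p ∖ q) N
  (λ u _ pu → ∖-keep p q u pu (λ { refl → ¬pq pu })) (λ u _ → ∖-⊆ p q u)))

-- Pigeonhole principle: the image of the largest element is removed from q before the smaller
-- elements are treated.
count-injection : ∀ p N (g : ℕ → ℕ) M q →
  (∀ u → u < N → p u ≡ 0 → g u < M × q (g u) ≡ 0) →
  (∀ u v → p u ≡ 0 → p v ≡ 0 → g u ≡ g v → u ≡ v) →
  count p N ≤ count q M
count-injection p zero    g M q into inj = z≤n
count-injection p (suc N) g M q into inj with p N in pN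
... | suc k = subst (λ z → z + count p N ≤ count q M) (sym (0∸n≡0 k))
  (count-injection p N g M q (λ u u<N → into u (m≤n⇒m≤1+n u<N)) inj)
... | zero = let gN<M , qgN = into N ≤-refl pN in
  subst (suc (count p N) ≤_) (sym (count-∖ q (g N) M qgN gN<M))
    (s≤s (count-injection p N g M (q ∖ g N)
      (λ u u<N pu → let gu<M , qgu = into u (m≤n⇒m≤1+n u<N) pu in
        gu<M , ∖-keep q (g N) (g u) qgu (λ e → <⇒≢ u<N (inj u N pu pN e)))
      inj))

Big : Pred → ℕ → Set
Big p m = Σ ℕ λ N → m ≤ count p N

infix 4 _≼_
-- Comparison of cardinalities through finite cuts: q has at least as many elements as p, where all
-- infinite sets count as equally large.
_≼_ : Pred → Pred → Set
p ≼ q = ∀ N → Big q (count p N)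

Big-mono : ∀ {p m n} → m ≤ n → Big p n → Big p m
Big-mono m≤n (N , le) = N , ≤-trans m≤n le

≼-Big : ∀ {p q m} → p ≼ q → Big p m → Big q m
≼-Big {q = q} p≼q (N , le) = Big-mono {q} le (p≼q N)

injection⇒≼ : ∀ p q (g : ℕ → ℕ) → (∀ u → p u ≡ 0 → q (g u) ≡ 0) →
  (∀ u v → p u ≡ 0 → p v ≡ 0 → g u ≡ g v → u ≡ v) → p ≼ q
-- The sum of all values of g below N bounds each of them.
injection⇒≼ p q g into inj N = suc (sum< N g) ,
  count-injection p N g (suc (sum< N g)) q (λ u u<N pu → s≤s (≤-sum< N g u u<N) , into u pu) inj

elements : Pred → ℕ → List ℕ
elements p zero    = []
elements p (suc N) with p N
... | zero  = N ∷ elements p N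
... | suc _ = elements p N

length-elements : ∀ p N → length (elements p N) ≡ count p N
length-elements p zero = refl
length-elements p (suc N) with p N
... | zero  = cong suc (length-elements p N)
... | suc k = trans (length-elements p N) (cong (_+ count p N) (sym (0∸n≡0 k)))

∈-elements : ∀ p N u → u < N → p u ≡ 0 → u ∈ elements p N
∈-elements p (suc N) u u<sN pu with m≤n⇒m<n∨m≡n (≤-pred u<sN)
... | inj₂ refl rewrite pu = here refl
... | inj₁ u<N with p N
...   | zero  = there (∈-elements p N u u<N pu)
...   | suc _ = ∈-elements p N u u<N pu

count-cover : ∀ p N (l : List ℕ) → (∀ u → p u ≡ 0 → u ∈ l) → count p N ≤ length l
count-cover p N [] cover = ≤-reflexive (none N)
  where
  none : ∀ N → count p N ≡ 0
  none zero = refl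
  none (suc N) with p N in pN
  ... | suc k = trans (cong (_+ count p N) (0∸n≡0 k)) (none N)
  ... | zero with cover N pN
  ...   | ()
count-cover p N (q ∷ l) cover = ≤-trans (count-∖-≤ p q N) (s≤s (count-cover (p ∖ q) N l cover′))
  where
  cover′ : ∀ u → (p ∖ q) u ≡ 0 → u ∈ l
  cover′ u e with cover u (∖-⊆ p q u e)
  ... | there u∈l = u∈l
  ... | here refl = ⊥-elim (∖-self p q e)

-- Classes and embeddings

-- A computable equivalence structure as a computable partial equivalence
-- relation; its universe is the set of self-related numbers.
record Per : Set where
  field
    rel    : Fn 2
    sym≈   : ∀ {x y} → app₂ rel x y ≡ 0 → app₂ rel y x ≡ 0
    trans≈ : ∀ {x y z} → app₂ rel x y ≡ 0 → app₂ rel y z ≡ 0 → app₂ rel x z ≡ 0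
open Per

infix 4 _⊢_≈_
_⊢_≈_ : Per → ℕ → ℕ → Set
R ⊢ x ≈ y = app₂ (rel R) x y ≡ 0

cls : Per → ℕ → Pred
cls R x = app₂ (rel R) x

reflˡ : ∀ R {x y} → R ⊢ x ≈ y → R ⊢ x ≈ x
reflˡ R e = trans≈ R e (sym≈ R e)

reflʳ : ∀ R {x y} → R ⊢ x ≈ y → R ⊢ y ≈ y
reflʳ R e = trans≈ R (sym≈ R e) e

count-cls : ∀ R {x y} N → R ⊢ x ≈ y → count (cls R x) N ≡ count (cls R y) N
count-cls R {x} {y} N x≈y = count-cong (cls R x) (cls R y) N
  (λ u _ → trans≈ R (sym≈ R x≈y)) (λ u _ → trans≈ R x≈y)

Big-cls : ∀ R {x y m} → R ⊢ x ≈ y → Big (cls R x) m → Big (cls R y) m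
Big-cls R {m = m} x≈y (N , le) = N , subst (m ≤_) (count-cls R N x≈y) le

record Emb (R S : Per) (f : ℕ → ℕ) : Set where
  field
    preserves : ∀ {x y} → R ⊢ x ≈ y → S ⊢ f x ≈ f y
    reflects  : ∀ {x y} → R ⊢ x ≈ x → R ⊢ y ≈ y → S ⊢ f x ≈ f y → R ⊢ x ≈ y
    injective : ∀ {x y} → R ⊢ x ≈ x → R ⊢ y ≈ y → f x ≡ f y → x ≡ y

-- An embedding seen only on classes: distinct classes go to distinct classes at least as large,
-- while elements of one class may still be identified.
record ClassMap (R S : Per) (T : ℕ → ℕ) : Set where
  field
    preserves : ∀ {x y} → R ⊢ x ≈ y → S ⊢ T x ≈ T y
    reflects  : ∀ {x y} → R ⊢ x ≈ x → R ⊢ y ≈ y → S ⊢ T x ≈ T y → R ⊢ x ≈ y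
    size      : ∀ {x} → R ⊢ x ≈ x → cls R x ≼ cls S (T x)

emb-≼ : ∀ {R S f} → Emb R S f → ∀ x → cls R x ≼ cls S (f x)
emb-≼ {R} {S} {f} h x = injection⇒≼ (cls R x) (cls S (f x)) f (λ u → preserves)
  (λ u v x≈u x≈v → injective (reflʳ R x≈u) (reflʳ R x≈v))
  where open Emb h

emb-∘ : ∀ {R S U f g} → Emb R S f → Emb S U g → Emb R U (g ∘ f)
emb-∘ F G = record
  { preserves = λ e → G.preserves (F.preserves e)
  ; reflects  = λ x y e → F.reflects x y (G.reflects (F.preserves x) (F.preserves y) e)
  ; injective = λ x y e → F.injective x y (G.injective (F.preserves x) (F.preserves y) e)
  }
  where
  module F = Emb F
  module G = Emb G

-- The number of smaller elements in the class of x.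
pos : Per → ℕ → ℕ
pos R x = count (cls R x) x

posᶠ : Per → Fn 1
posᶠ R = sumᶠ (const 1 ∸ᶠ rel R ⟦ v1 ∷ v0 ∷ [] ⟧) ⟦ v0 ∷ v0 ∷ [] ⟧

pos-< : ∀ R {x y} → R ⊢ x ≈ y → x < y → pos R x < pos R y
pos-< R {x} {y} x≈y x<y =
  subst (pos R x <_) (count-cls R y x≈y) (count-< (cls R x) (reflˡ R x≈y) x<y)

pos-injective : ∀ R {x y} → R ⊢ x ≈ y → pos R x ≡ pos R y → x ≡ y
pos-injective R {x} {y} x≈y e with <-cmp x y
... | tri< x<y _ _ = ⊥-elim (<⇒≢ (pos-< R x≈y x<y) e)
... | tri≈ _ x≡y _ = x≡y
... | tri> _ _ y<x = ⊥-elim (<⇒≢ (pos-< R (sym≈ R x≈y) y<x) (sym e))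

module _ {R S : Per} {T : ℕ → ℕ} (cm : ClassMap R S T) where
  open ClassMap cm

  -- Matching positions inside corresponding classes makes the embedding canonical,
  -- hence computable when T is.
  Image : ℕ → ℕ → Set
  Image x y = S ⊢ T x ≈ y × pos S y ≡ pos R x

  image : ∀ {x} → R ⊢ x ≈ x → Σ ℕ (Image x)
  image {x} x≈x =
    -- The cut at `suc x` includes x, so the target class has more than `pos R x` elements and
    -- therefore one at that position.
    let N , le = size x≈x (suc x)
        y , Tx≈y , c = nth (cls S (T x)) N (pos R x) (subst (_≤ count (cls S (T x)) N) (count-in (cls R x) x x≈x) le)
    in y , Tx≈y , trans (sym (count-cls S y Tx≈y)) c

  image⇒emb : ∀ {f} → (∀ {x} → R ⊢ x ≈ x → Image x (f x)) → Emb R S f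
  image⇒emb {f} im = record
    { preserves = λ e → trans≈ S (sym≈ S (proj₁ (im (reflˡ R e)))) (trans≈ S (preserves e) (proj₁ (im (reflʳ R e))))
    ; reflects  = λ x y e → reflects x y (back x y e)
    ; injective = λ {x} {y} x≈x y≈y e → pos-injective R
        (reflects x≈x y≈y (back x≈x y≈y (subst (S ⊢ f x ≈_) e (reflʳ S (proj₁ (im x≈x))))))
        (trans (sym (proj₂ (im x≈x))) (trans (cong (pos S) e) (proj₂ (im y≈y))))
    }
    where
    back : ∀ {x y} → R ⊢ x ≈ x → R ⊢ y ≈ y → S ⊢ f x ≈ f y → S ⊢ T x ≈ T y
    back x≈x y≈y e = trans≈ S (proj₁ (im x≈x)) (trans≈ S e (sym≈ S (proj₁ (im y≈y))))

  classMap⇒emb : Σ (ℕ → ℕ) (Emb R S)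
  classMap⇒emb = (λ x → f (app₂ (rel R) x x ≟ 0)) , image⇒emb λ {x} x≈x → f-image x≈x (app₂ (rel R) x x ≟ 0)
    where
    f : ∀ {x} → Dec (R ⊢ x ≈ x) → ℕ
    f (yes x≈x) = proj₁ (image x≈x)
    f (no _)    = 0
    f-image : ∀ {x} → R ⊢ x ≈ x → (d : Dec (R ⊢ x ≈ x)) → Image x (f d)
    f-image x≈x (yes p)  = proj₂ (image p)
    f-image x≈x (no x≉x) = ⊥-elim (x≉x x≈x)

classMap⇒embᶠ : ∀ {R S} (T : Fn 1) → ClassMap R S (app₁ T) → Σ (Fn 1) λ f → Emb R S (app₁ f)
classMap⇒embᶠ {R} {S} T cm = f , image⇒emb cm f-image
  where
  search : Fn 2
  search = (rel S ⟦ T ⟦ v1 ∷ [] ⟧ ∷ v0 ∷ [] ⟧ +ᶠ eqᶠ (posᶠ S ⟦ v0 ∷ [] ⟧) (posᶠ R ⟦ v1 ∷ [] ⟧))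
           -- This factor vanishes outside the universe of R, where the search then stops at 0; this
           -- keeps the minimisation total.
           *ᶠ (const 1 ∸ᶠ rel R ⟦ v1 ∷ v1 ∷ [] ⟧)
  total : ∀ xs → Σ ℕ λ y → fun search (y ∷ xs) ≡ 0
  total (x ∷ []) with app₂ (rel R) x x ≟ 0
  ... | yes x≈x = let y , Tx≈y , p = image cm x≈x in y ,
    cong (_* (1 ∸ app₂ (rel R) x x)) (cong₂ _+_ Tx≈y (trans (cong (λ z → eqᴺ z (pos R x)) p) (eqᴺ-refl (pos R x))))
  ... | no x≉x = 0 , trans (cong (a *_) (≢0⇒∸ x≉x)) (*-zeroʳ a)
    where
    a : ℕ
    a = app₂ (rel S) (app₁ T x) 0 + eqᴺ (pos S 0) (pos R x)
  f : Fn 1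
  f = minimise search total
  search-image : ∀ {x} y → R ⊢ x ≈ x → app₂ search y x ≡ 0 → Image cm x y
  search-image {x} y x≈x e with m*n≡0⇒m≡0∨n≡0 (app₂ (rel S) (app₁ T x) y + eqᴺ (pos S y) (pos R x)) e
  ... | inj₁ e′ = m+n≡0⇒m≡0 (app₂ (rel S) (app₁ T x) y) e′ ,
                  eqᴺ-sound (pos S y) (pos R x) (m+n≡0⇒n≡0 (app₂ (rel S) (app₁ T x) y) e′)
  ... | inj₂ e′ = ⊥-elim (∸-zero e′ x≈x)
  f-image : ∀ {x} → R ⊢ x ≈ x → Image cm x (app₁ f x)
  f-image {x} x≈x = search-image (app₁ f x) x≈x (proj₁ (minimise-least search total (x ∷ [])))

module _ (R : Per) where
  private
    search : Fn 2
    search = rel R ⟦ v1 ∷ v0 ∷ [] ⟧ *ᶠ (const 1 ∸ᶠ rel R ⟦ v1 ∷ v1 ∷ [] ⟧)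
    total : ∀ xs → Σ ℕ λ y → fun search (y ∷ xs) ≡ 0
    total (x ∷ []) with app₂ (rel R) x x ≟ 0
    ... | yes x≈x = x , cong (_* (1 ∸ app₂ (rel R) x x)) x≈x
    ... | no x≉x  = 0 , trans (cong (app₂ (rel R) x 0 *_) (≢0⇒∸ x≉x)) (*-zeroʳ (app₂ (rel R) x 0))
  -- Least elements serve as computable names of classes, constant on each class by `rep-cong`.
  repᶠ : Fn 1
  repᶠ = minimise search total

  rep : ℕ → ℕ
  rep = app₁ repᶠ

  private
    rep-least : ∀ {x} → R ⊢ x ≈ x → Least (cls R x) (rep x)
    rep-least {x} x≈x with minimise-least search total (x ∷ [])
    ... | e , below = rel≡0 , λ z z<r → let k , e′ = below z z<r in pred (app₂ (rel R) x z) , suc-of z e′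
      where
      rel≡0 : R ⊢ x ≈ rep x
      rel≡0 with m*n≡0⇒m≡0∨n≡0 (app₂ (rel R) x (rep x)) e
      ... | inj₁ e = e
      ... | inj₂ e = ⊥-elim (∸-zero e x≈x)
      suc-of : ∀ z {k} → app₂ (rel R) x z * (1 ∸ app₂ (rel R) x x) ≡ suc k → app₂ (rel R) x z ≡ suc (pred (app₂ (rel R) x z))
      suc-of z e′ with app₂ (rel R) x z
      ... | zero with e′
      ...   | ()
      suc-of z e′ | suc _ = refl

  rep-≈ : ∀ {x} → R ⊢ x ≈ x → R ⊢ x ≈ rep x
  rep-≈ x≈x = proj₁ (rep-least x≈x)

  rep-cong : ∀ {x y} → R ⊢ x ≈ y → rep x ≡ rep y
  rep-cong {x} {y} x≈y = ≤-antisym (rep-≤ x≈y) (rep-≤ (sym≈ R x≈y))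
    where
    rep-≤ : ∀ {x y} → R ⊢ x ≈ y → rep x ≤ rep y
    rep-≤ {x} {y} x≈y = ≮⇒≥ λ ry<rx →
      let k , e = proj₂ (rep-least (reflˡ R x≈y)) (rep y) ry<rx
      in 1+n≢0 (trans (sym e) (trans≈ R x≈y (rep-≈ (reflʳ R x≈y))))

-- A class map assembled from a map η on a class-invariant set of special
-- elements and a map τ on the least elements of the remaining classes.
record Gluing (R S : Per) (special : Pred) (η τ : ℕ → ℕ) : Set where
  Ordinary : ℕ → Set
  Ordinary n = R ⊢ n ≈ n × special n ≢ 0
  field
    special-resp : ∀ {x y} → R ⊢ x ≈ y → special x ≡ 0 → special y ≡ 0
    η-preserves  : ∀ {x y} → R ⊢ x ≈ y → special x ≡ 0 → S ⊢ η x ≈ η y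
    η-reflects   : ∀ {x y} → R ⊢ x ≈ x → R ⊢ y ≈ y → special x ≡ 0 → special y ≡ 0 → S ⊢ η x ≈ η y → R ⊢ x ≈ y
    η-size       : ∀ {x} → R ⊢ x ≈ x → special x ≡ 0 → cls R x ≼ cls S (η x)
    τ-dom        : ∀ {n} → Ordinary n → S ⊢ τ n ≈ τ n
    τ-separates  : ∀ {m n} → Ordinary m → Ordinary n → S ⊢ τ m ≈ τ n → m ≡ n
    τ-avoids     : ∀ {n x} → Ordinary n → R ⊢ x ≈ x → special x ≡ 0 → ¬ S ⊢ τ n ≈ η x
    τ-size       : ∀ {n} → Ordinary n → cls R n ≼ cls S (τ n)

module _ {R S : Per} {special : Pred} {η τ : ℕ → ℕ} (g : Gluing R S special η τ) where
  open Gluing g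

  glued : ℕ → ℕ
  glued x = ifz (special x) (η x) (τ (rep R x))

  private
    glued-special : ∀ {x} → special x ≡ 0 → glued x ≡ η x
    glued-special e rewrite e = refl

    glued-ordinary : ∀ {x} → special x ≢ 0 → glued x ≡ τ (rep R x)
    glued-ordinary {x} ne with special x
    ... | zero  = ⊥-elim (ne refl)
    ... | suc _ = refl

    rep-ordinary : ∀ {x} → R ⊢ x ≈ x → special x ≢ 0 → Ordinary (rep R x)
    rep-ordinary x≈x ne = reflʳ R (rep-≈ R x≈x) , λ e → ne (special-resp (sym≈ R (rep-≈ R x≈x)) e)

  glued-classMap : ClassMap R S glued
  glued-classMap = record { preserves = pre ; reflects = ref ; size = siz }
    where
    pre : ∀ {x y} → R ⊢ x ≈ y → S ⊢ glued x ≈ glued y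
    pre {x} {y} x≈y with special x ≟ 0
    ... | yes sx rewrite glued-special sx | glued-special (special-resp x≈y sx) = η-preserves x≈y sx
    ... | no ¬sx rewrite glued-ordinary ¬sx
                       | glued-ordinary (λ sy → ¬sx (special-resp (sym≈ R x≈y) sy))
                       | rep-cong R x≈y
      = τ-dom (rep-ordinary (reflʳ R x≈y) (λ sy → ¬sx (special-resp (sym≈ R x≈y) sy)))
    ref : ∀ {x y} → R ⊢ x ≈ x → R ⊢ y ≈ y → S ⊢ glued x ≈ glued y → R ⊢ x ≈ y
    ref {x} {y} x≈x y≈y e with special x ≟ 0 | special y ≟ 0
    ... | yes sx | yes sy rewrite glued-special sx | glued-special sy = η-reflects x≈x y≈y sx sy e
    ... | yes sx | no ¬sy rewrite glued-special sx | glued-ordinary ¬sy =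
      ⊥-elim (τ-avoids (rep-ordinary y≈y ¬sy) x≈x sx (sym≈ S e))
    ... | no ¬sx | yes sy rewrite glued-ordinary ¬sx | glued-special sy =
      ⊥-elim (τ-avoids (rep-ordinary x≈x ¬sx) y≈y sy e)
    ... | no ¬sx | no ¬sy rewrite glued-ordinary ¬sx | glued-ordinary ¬sy =
      trans≈ R (rep-≈ R x≈x) (sym≈ R (subst (R ⊢ y ≈_)
        (sym (τ-separates (rep-ordinary x≈x ¬sx) (rep-ordinary y≈y ¬sy) e)) (rep-≈ R y≈y)))
    siz : ∀ {x} → R ⊢ x ≈ x → cls R x ≼ cls S (glued x)
    siz {x} x≈x with special x ≟ 0
    ... | yes sx rewrite glued-special sx = η-size x≈x sx
    ... | no ¬sx rewrite glued-ordinary ¬sx = λ N →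
      subst (Big (cls S (τ (rep R x)))) (sym (count-cls R N (rep-≈ R x≈x))) (τ-size (rep-ordinary x≈x ¬sx) N)

-- Sufficiency of the condition

Meets : Per → ℕ → List ℕ → Set
Meets R x L = Any (λ r → R ⊢ x ≈ r) L

Meets-resp : ∀ R {x y} L → R ⊢ x ≈ y → Meets R x L → Meets R y L
Meets-resp R (r ∷ L) x≈y (here x≈r) = here (trans≈ R (sym≈ R x≈y) x≈r)
Meets-resp R (r ∷ L) x≈y (there p)  = there (Meets-resp R L x≈y p)

meetsᶠ : Per → List ℕ → Fn 1
meetsᶠ R []      = const 1
meetsᶠ R (r ∷ L) = rel R ⟦ v0 ∷ const r ∷ [] ⟧ *ᶠ meetsᶠ R L

meetsᶠ-sound : ∀ R L x → app₁ (meetsᶠ R L) x ≡ 0 → Meets R x L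
meetsᶠ-sound R (r ∷ L) x e with m*n≡0⇒m≡0∨n≡0 (app₂ (rel R) x r) e
... | inj₁ x≈r = here x≈r
... | inj₂ e′  = there (meetsᶠ-sound R L x e′)

meetsᶠ-complete : ∀ R L x → Meets R x L → app₁ (meetsᶠ R L) x ≡ 0
meetsᶠ-complete R (r ∷ L) x (here x≈r) = cong (_* app₁ (meetsᶠ R L) x) x≈r
meetsᶠ-complete R (r ∷ L) x (there p)  =
  trans (cong (app₂ (rel R) x r *_) (meetsᶠ-complete R L x p)) (*-zeroʳ (app₂ (rel R) x r))

-- Hard-codes finitely many values of h, which need not be computable.
tableᶠ : Per → (ℕ → ℕ) → List ℕ → Fn 1
tableᶠ R h []      = const 0
tableᶠ R h (r ∷ L) = ifzᶠ (rel R ⟦ v0 ∷ const r ∷ [] ⟧) (const (h r)) (tableᶠ R h L)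

tableᶠ-spec : ∀ R h L x → Meets R x L → Σ ℕ λ r → r ∈ L × R ⊢ x ≈ r × app₁ (tableᶠ R h L) x ≡ h r
tableᶠ-spec R h (r ∷ L) x meets with app₂ (rel R) x r in e
... | zero  = r , here refl , e , refl
tableᶠ-spec R h (r ∷ L) x (here x≈r) | suc k = ⊥-elim (1+n≢0 (trans (sym e) x≈r))
tableᶠ-spec R h (r ∷ L) x (there p)  | suc k =
  let r′ , r′∈L , x≈r′ , eq = tableᶠ-spec R h L x p in r′ , there r′∈L , x≈r′ , eq

-- Infinitely many classes have at least m elements; `Thin` says that only finitely many do.
Rich : Per → ℕ → Set
Rich R m = ∀ L → Σ ℕ λ x → R ⊢ x ≈ x × ¬ Meets R x L × Big (cls R x) m

Thin : Per → ℕ → Set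
Thin R m = Σ (List ℕ) λ L → ∀ x → R ⊢ x ≈ x → Meets R x L ⊎ ¬ Big (cls R x) m

Infinite : Pred → Set
Infinite p = ∀ N → Σ ℕ λ t → N ≤ t × p t ≡ 0

infinite⇒Big : ∀ {p} → Infinite p → ∀ m → Big p m
infinite⇒Big inf zero = 0 , z≤n
infinite⇒Big {p} inf (suc m) =
  let N , le = infinite⇒Big {p} inf m
      t , N≤t , pt = inf N
  in suc t , ≤-trans (s≤s (≤-trans le (count-mono p N≤t))) (≤-reflexive (sym (count-in p t pt)))

module _ (G : Fn 1) (inf : Infinite (app₁ G)) where
  private
    search : Fn 2
    search = G ⟦ v0 ∷ [] ⟧ +ᶠ eqᶠ (sumᶠ (const 1 ∸ᶠ G) ⟦ v0 ∷ [] ⟧) v1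
    total : ∀ xs → Σ ℕ λ y → fun search (y ∷ xs) ≡ 0
    total (n ∷ []) =
      let N , le = infinite⇒Big inf (suc n)
          t , Gt , c = nth (app₁ G) N n le
      in t , cong₂ _+_ Gt (trans (cong (λ z → eqᴺ z n) c) (eqᴺ-refl n))

  nthᶠ : Fn 1
  nthᶠ = minimise search total

  private
    search-spec : ∀ n y → app₂ search y n ≡ 0 → app₁ G y ≡ 0 × count (app₁ G) y ≡ n
    search-spec n y e = m+n≡0⇒m≡0 (app₁ G y) e , eqᴺ-sound (count (app₁ G) y) n (m+n≡0⇒n≡0 (app₁ G y) e)

  nthᶠ-spec : ∀ n → app₁ G (app₁ nthᶠ n) ≡ 0 × count (app₁ G) (app₁ nthᶠ n) ≡ n
  nthᶠ-spec n = search-spec n (app₁ nthᶠ n) (proj₁ (minimise-least search total (n ∷ [])))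

module Classical (em : ExcludedMiddle 0ℓ) where

  ¬thin⇒rich : ∀ R m → ¬ Thin R m → Rich R m
  ¬thin⇒rich R m ¬thin L with em {Σ ℕ λ x → R ⊢ x ≈ x × ¬ Meets R x L × Big (cls R x) m}
  ... | yes found = found
  ... | no none   = ⊥-elim (¬thin (L , cover))
    where
    cover : ∀ x → R ⊢ x ≈ x → Meets R x L ⊎ ¬ Big (cls R x) m
    cover x x≈x with em {Meets R x L}
    ... | yes meets = inj₁ meets
    ... | no apart  = inj₂ λ big → none (x , x≈x , apart , big)

  -- As h reflects equivalence, at most one class of R is sent into a given class of S; excluded
  -- middle decides whether there is one.
  preimages : ∀ {R S h} → Emb R S h → ∀ L → Σ (List ℕ) λ L′ → ∀ x → R ⊢ x ≈ x → Meets S (h x) L → Meets R x L′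
  preimages H [] = [] , λ _ _ ()
  preimages {R} {S} {h} H (r ∷ L) with preimages H L | em {Σ ℕ λ z → R ⊢ z ≈ z × S ⊢ h z ≈ r}
  ... | L′ , meets′ | yes (z , z≈z , hz≈r) = z ∷ L′ , λ
    { x x≈x (here hx≈r) → here (Emb.reflects H x≈x z≈z (trans≈ S hx≈r (sym≈ S hz≈r)))
    ; x x≈x (there p)   → there (meets′ x x≈x p) }
  ... | L′ , meets′ | no none = L′ , λ
    { x x≈x (here hx≈r) → ⊥-elim (none (x , x≈x , hx≈r))
    ; x x≈x (there p)   → meets′ x x≈x p }

  -- Classes do not shrink under an embedding, and only finitely many land in the exceptional
  -- classes of S.
  thin-pullback : ∀ {R S h m} → Emb R S h → Thin S m → Thin R m
  thin-pullback {R} {S} {h} {m} H (L , cover) = let L′ , meets′ = preimages H L in L′ , λ x x≈x →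
    [ (λ meets → inj₁ (meets′ x x≈x meets))
    , (λ ¬big → inj₂ λ big → ¬big (≼-Big {cls R x} {cls S (h x)} (emb-≼ H x) big))
    ]′ (cover (h x) (Emb.preserves H x≈x))

  -- The infinitely many target classes of size at least suc m, each represented
  -- by its m-th element, receive the ordinary classes, whose size is at most suc m.
  module Computable-embedding {R S h} (H : Emb R S h) {L m}
    (rich : Rich R (suc m))
    (cover : ∀ x → R ⊢ x ≈ x → Meets R x L ⊎ ¬ Big (cls R x) (2 + m)) where

    targetᶠ : Fn 1
    targetᶠ = rel S ⟦ v0 ∷ v0 ∷ [] ⟧ +ᶠ (const 1 ∸ᶠ meetsᶠ S (List.map h L)) +ᶠ eqᶠ (posᶠ S) (const m)

    Target : ℕ → Set
    Target t = S ⊢ t ≈ t × ¬ Meets S t (List.map h L) × pos S t ≡ m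

    target-sound : ∀ t → app₁ targetᶠ t ≡ 0 → Target t
    target-sound t e = m+n≡0⇒m≡0 (app₂ (rel S) t t) e₁ ,
      (λ meets → ∸-zero (m+n≡0⇒n≡0 (app₂ (rel S) t t) e₁) (meetsᶠ-complete S (List.map h L) t meets)) ,
      eqᴺ-sound (pos S t) m (m+n≡0⇒n≡0 (app₂ (rel S) t t + (1 ∸ app₁ (meetsᶠ S (List.map h L)) t)) e)
      where
      e₁ : app₂ (rel S) t t + (1 ∸ app₁ (meetsᶠ S (List.map h L)) t) ≡ 0
      e₁ = m+n≡0⇒m≡0 _ e

    target-complete : ∀ t → Target t → app₁ targetᶠ t ≡ 0
    target-complete t (t≈t , apart , p) = cong₂ _+_
      (cong₂ _+_ t≈t (≢0⇒∸ (λ e → apart (meetsᶠ-sound S (List.map h L) t e))))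
      (trans (cong (λ z → eqᴺ z m) p) (eqᴺ-refl m))

    -- Richness gives a class whose image avoids the images of L and the classes of all numbers
    -- below N. The element at position m in the image class is then at least N.
    infinitely-many-targets : Infinite (app₁ targetᶠ)
    infinitely-many-targets N =
      let L′ , meets′ = preimages H (List.map h L ++ downFrom N)
          x , x≈x , apart , big = rich L′
          M , le = ≼-Big {cls R x} {cls S (h x)} (emb-≼ H x) big
          t , hx≈t , c = nth (cls S (h x)) M m le
          avoid = λ meets → apart (meets′ x x≈x (Meets-resp S (List.map h L ++ downFrom N) (sym≈ S hx≈t) meets))
          t≈t = reflʳ S hx≈t
      in t , ≮⇒≥ (λ t<N → avoid (++⁺ʳ (List.map h L) (lose (∈-downFrom⁺ t<N) t≈t))) ,
         target-complete t (t≈t , (λ meets → avoid (++⁺ˡ meets)) , trans (sym (count-cls S t hx≈t)) c)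

    τᶠ : Fn 1
    τᶠ = nthᶠ targetᶠ infinitely-many-targets

    τ : ℕ → ℕ
    τ = app₁ τᶠ

    τ-target : ∀ n → Target (τ n)
    τ-target n = target-sound (τ n) (proj₁ (nthᶠ-spec targetᶠ infinitely-many-targets n))

    τ-injective : ∀ {i j} → τ i ≡ τ j → i ≡ j
    τ-injective {i} {j} e = trans (sym (index i)) (trans (cong (count (app₁ targetᶠ)) e) (index j))
      where
      index : ∀ n → count (app₁ targetᶠ) (τ n) ≡ n
      index n = proj₂ (nthᶠ-spec targetᶠ infinitely-many-targets n)

    ordinary-size : ∀ {n} → R ⊢ n ≈ n → app₁ (meetsᶠ R L) n ≢ 0 → cls R n ≼ cls S (τ n)
    ordinary-size {n} n≈n ¬special N = suc (τ n) , (begin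
      count (cls R n) N              ≤⟨ ≮⇒≥ (λ big → ¬big (N , big)) ⟩
      suc m                          ≡⟨ cong suc (sym pos≡m) ⟩
      suc (pos S (τ n))              ≡⟨ sym (count-in (cls S (τ n)) (τ n) τn≈τn) ⟩
      count (cls S (τ n)) (suc (τ n)) ∎)
      where
      open ≤-Reasoning
      τn≈τn = proj₁ (τ-target n)
      pos≡m = proj₂ (proj₂ (τ-target n))
      ¬big : ¬ Big (cls R n) (2 + m)
      ¬big = [ (λ meets → ⊥-elim (¬special (meetsᶠ-complete R L n meets))) , id ]′ (cover n n≈n)

  module Special {R S h} (H : Emb R S h) (L : List ℕ) where
    ηᶠ : Fn 1
    ηᶠ = tableᶠ R h L

    special : Pred
    special = app₁ (meetsᶠ R L)

    special-resp : ∀ {x y} → R ⊢ x ≈ y → special x ≡ 0 → special y ≡ 0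
    special-resp {x} {y} x≈y sx = meetsᶠ-complete R L y (Meets-resp R L x≈y (meetsᶠ-sound R L x sx))

    η-value : ∀ x → special x ≡ 0 → Σ ℕ λ r → r ∈ L × R ⊢ x ≈ r × app₁ ηᶠ x ≡ h r
    η-value x sx = tableᶠ-spec R h L x (meetsᶠ-sound R L x sx)

    η≈h : ∀ {x} → special x ≡ 0 → S ⊢ app₁ ηᶠ x ≈ h x
    η≈h {x} sx = let r , _ , x≈r , e = η-value x sx in
      subst (λ z → S ⊢ z ≈ h x) (sym e) (Emb.preserves H (sym≈ R x≈r))

    -- On special classes η agrees with h up to equivalence, so only the conditions on τ are left to
    -- check.
    gluing : ∀ {τ} →
      (∀ {n} → R ⊢ n ≈ n → special n ≢ 0 → S ⊢ τ n ≈ τ n × ¬ Meets S (τ n) (List.map h L)) →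
      (∀ {i j} → R ⊢ i ≈ i → special i ≢ 0 → S ⊢ τ i ≈ τ j → i ≡ j) →
      (∀ {n} → R ⊢ n ≈ n → special n ≢ 0 → cls R n ≼ cls S (τ n)) →
      Gluing R S special (app₁ ηᶠ) τ
    gluing dom separates size = record
      { special-resp = special-resp
      ; η-preserves  = λ x≈y sx → trans≈ S (η≈h sx) (trans≈ S (Emb.preserves H x≈y) (sym≈ S (η≈h (special-resp x≈y sx))))
      ; η-reflects   = λ x≈x y≈y sx sy e → Emb.reflects H x≈x y≈y (trans≈ S (sym≈ S (η≈h sx)) (trans≈ S e (η≈h sy)))
      ; η-size       = λ {x} x≈x sx N → Big-cls S (sym≈ S (η≈h sx)) (emb-≼ H x N)
      ; τ-dom        = λ (n≈n , ¬s) → proj₁ (dom n≈n ¬s)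
      ; τ-separates  = λ (m≈m , ¬s) _ → separates m≈m ¬s
      ; τ-avoids     = λ {n} {x} (n≈n , ¬s) x≈x sx e → let r , r∈L , _ , eq = η-value x sx in
          proj₂ (dom n≈n ¬s) (lose (∈-map⁺ h r∈L) (subst (S ⊢ _ ≈_) eq e))
      ; τ-size       = λ (n≈n , ¬s) → size n≈n ¬s
      }

  -- Lowers the threshold while thinness persists. Thinness at 1 means finitely many classes; at 0
  -- it already implies this, since every set has at least 0 elements.
  least-thin : ∀ R m → Thin R m → Thin R 1 ⊎ Σ ℕ λ m′ → Rich R (suc m′) × Thin R (2 + m′)
  least-thin R zero (L , cover) = inj₁ (L , λ x x≈x →
    [ inj₁ , (λ ¬big → ⊥-elim (¬big (0 , z≤n))) ]′ (cover x x≈x))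
  least-thin R (suc zero) thin = inj₁ thin
  least-thin R (suc (suc m)) thin = thinner? em (least-thin R (suc m))
    where
    Result : Set
    Result = Thin R 1 ⊎ Σ ℕ λ m′ → Rich R (suc m′) × Thin R (2 + m′)
    thinner? : Dec (Thin R (suc m)) → (Thin R (suc m) → Result) → Result
    thinner? (yes thinner) recurse = recurse thinner
    thinner? (no ¬thinner) _       = inj₂ (m , ¬thin⇒rich R (suc m) ¬thinner , thin)

  thin⇒embᶠ : ∀ {R S h m} → Thin R m → Emb R S h → Σ (Fn 1) λ f → Emb R S (app₁ f)
  thin⇒embᶠ {R} {S} {h} {m} thin H with least-thin R m thin
  -- With finitely many classes every element is special, so the conditions on the constant τ hold
  -- vacuously.
  ... | inj₁ (L , cover) = classMap⇒embᶠ (ifzᶠ (meetsᶠ R L) (tableᶠ R h L) (const 0 ⟦ repᶠ R ∷ [] ⟧))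
    (glued-classMap (gluing {λ _ → 0}
      (λ n≈n ¬s → ⊥-elim (¬s (all-special n≈n)))
      (λ n≈n ¬s → ⊥-elim (¬s (all-special n≈n)))
      (λ n≈n ¬s → ⊥-elim (¬s (all-special n≈n)))))
    where
    open Special H L
    all-special : ∀ {n} → R ⊢ n ≈ n → special n ≡ 0
    all-special {n} n≈n = meetsᶠ-complete R L n ([ id , (λ ¬big → ⊥-elim (¬big
      (suc n , ≤-trans (s≤s z≤n) (≤-reflexive (sym (count-in (cls R n) n n≈n)))))) ]′ (cover n n≈n))
  ... | inj₂ (m′ , rich , L , cover) = classMap⇒embᶠ (ifzᶠ (meetsᶠ R L) (tableᶠ R h L) (τᶠ ⟦ repᶠ R ∷ [] ⟧))
    (glued-classMap (gluing {τ}
      (λ {n} _ _ → proj₁ (τ-target n) , proj₁ (proj₂ (τ-target n)))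
      (λ {i} {j} _ _ e → τ-injective (pos-injective S e
        (trans (proj₂ (proj₂ (τ-target i))) (sym (proj₂ (proj₂ (τ-target j)))))))
      ordinary-size))
    where
    open Special H L
    open Computable-embedding H rich cover

-- Necessity of the condition

≼-trans : ∀ p q r → p ≼ q → q ≼ r → p ≼ r
≼-trans p q r p≼q q≼r N = ≼-Big {q} {r} q≼r (p≼q N)

-- The classes of R meeting L (numbers ⟨ 0 , x ⟩) together with one class
-- { ⟨ suc i , s ⟩ | D i s = 0 } for each i.
module Mixture (R : Per) (L : List ℕ) (D : Fn 2) where

  row : ℕ → Pred
  row i = app₂ D i

  private
    mixᶠ : Fn 2
    mixᶠ = eqᶠ (fstᶠ v0) (fstᶠ v1) +ᶠ ifzᶠ (fstᶠ v0)
      (rel R ⟦ sndᶠ v0 ∷ sndᶠ v1 ∷ [] ⟧ +ᶠ meetsᶠ R L ⟦ sndᶠ v0 ∷ [] ⟧)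
      (D ⟦ predᶠ (fstᶠ v0) ∷ sndᶠ v0 ∷ [] ⟧ +ᶠ D ⟦ predᶠ (fstᶠ v0) ∷ sndᶠ v1 ∷ [] ⟧)

  data View (p q : ℕ) : Set where
    inner  : fst p ≡ 0 → fst q ≡ 0 → R ⊢ snd p ≈ snd q → Meets R (snd p) L → View p q
    in-row : ∀ i → fst p ≡ suc i → fst q ≡ suc i → row i (snd p) ≡ 0 → row i (snd q) ≡ 0 → View p q

  private
    view : ∀ {p q} → app₂ mixᶠ p q ≡ 0 → View p q
    view {p} {q} e with fst p in fp | eqᴺ-sound (fst p) (fst q) (m+n≡0⇒m≡0 _ e)
                      | m+n≡0⇒n≡0 (eqᴺ (fst p) (fst q)) e
    ... | zero  | p≡q | e′ = inner fp (sym p≡q) (m+n≡0⇒m≡0 _ e′)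
                               (meetsᶠ-sound R L (snd p) (m+n≡0⇒n≡0 (app₂ (rel R) (snd p) (snd q)) e′))
    ... | suc i | p≡q | e′ = in-row i fp (sym p≡q) (m+n≡0⇒m≡0 _ e′) (m+n≡0⇒n≡0 (row i (snd p)) e′)

    unview : ∀ {p q} → View p q → app₂ mixᶠ p q ≡ 0
    unview {p} {q} (inner fp fq x≈y meets) rewrite fp | fq =
      cong₂ _+_ x≈y (meetsᶠ-complete R L (snd p) meets)
    unview {p} {q} (in-row i fp fq Dp Dq) rewrite fp | fq =
      cong₂ _+_ (eqᴺ-refl i) (cong₂ _+_ Dp Dq)

    view-sym : ∀ {p q} → View p q → View q p
    view-sym (inner fp fq x≈y meets)  = inner fq fp (sym≈ R x≈y) (Meets-resp R L x≈y meets)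
    view-sym (in-row i fp fq Dp Dq) = in-row i fq fp Dq Dp

    view-trans : ∀ {p q r} → View p q → View q r → View p r
    view-trans (inner fp fq x≈y meets) (inner fq′ fr y≈z _) = inner fp fr (trans≈ R x≈y y≈z) meets
    view-trans (inner fp fq _ _) (in-row i fq′ _ _ _) = ⊥-elim (0≢1+n (trans (sym fq) fq′))
    view-trans (in-row i fp fq _ _) (inner fq′ _ _ _) = ⊥-elim (0≢1+n (trans (sym fq′) fq))
    view-trans (in-row i fp fq Dp _) (in-row j fq′ fr _ Dr) with suc-injective (trans (sym fq) fq′)
    ... | refl = in-row i fp fr Dp Dr

  mixture : Per
  mixture = record
    { rel    = mixᶠ
    ; sym≈   = λ e → unview (view-sym (view e))
    ; trans≈ = λ e e′ → unview (view-trans (view e) (view e′))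
    }

  mixture-view : ∀ {p q} → mixture ⊢ p ≈ q → View p q
  mixture-view = view

  mixture-fst : ∀ {p q} → mixture ⊢ p ≈ q → fst p ≡ fst q
  mixture-fst e with view e
  ... | inner fp fq _ _    = trans fp (sym fq)
  ... | in-row _ fp fq _ _ = trans fp (sym fq)

  inner-≈ : ∀ {x y} → R ⊢ x ≈ y → Meets R x L → mixture ⊢ ⟨ 0 , x ⟩ ≈ ⟨ 0 , y ⟩
  inner-≈ {x} {y} x≈y meets = unview (inner (fst-pair 0 x) (fst-pair 0 y)
    (subst₂ (R ⊢_≈_) (sym (snd-pair 0 x)) (sym (snd-pair 0 y)) x≈y)
    (subst (λ z → Meets R z L) (sym (snd-pair 0 x)) meets))

  inner-≈⁻ : ∀ {p q} → fst p ≡ 0 → mixture ⊢ p ≈ q → R ⊢ snd p ≈ snd q × Meets R (snd p) L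
  inner-≈⁻ fp e with view e
  ... | inner _ _ x≈y meets = x≈y , meets
  ... | in-row i fp′ _ _ _  = ⊥-elim (0≢1+n (trans (sym fp) fp′))

  row-≈ : ∀ {i s s′} → row i s ≡ 0 → row i s′ ≡ 0 → mixture ⊢ ⟨ suc i , s ⟩ ≈ ⟨ suc i , s′ ⟩
  row-≈ {i} {s} {s′} Ds Ds′ = unview (in-row i (fst-pair _ s) (fst-pair _ s′)
    (subst (λ z → row i z ≡ 0) (sym (snd-pair _ s)) Ds) (subst (λ z → row i z ≡ 0) (sym (snd-pair _ s′)) Ds′))

  private
    snd-injective : ∀ {p u v} → mixture ⊢ p ≈ u → mixture ⊢ p ≈ v → snd u ≡ snd v → u ≡ v
    snd-injective {p} {u} {v} p≈u p≈v e = begin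
      u                 ≡⟨ sym (pair-surj u) ⟩
      ⟨ fst u , snd u ⟩ ≡⟨ cong₂ ⟨_,_⟩ (trans (sym (mixture-fst p≈u)) (mixture-fst p≈v)) e ⟩
      ⟨ fst v , snd v ⟩ ≡⟨ pair-surj v ⟩
      v                 ∎
      where open ≡-Reasoning

  inner-≼ : ∀ {x} → Meets R x L → cls R x ≼ cls mixture ⟨ 0 , x ⟩
  inner-≼ {x} meets = injection⇒≼ (cls R x) (cls mixture ⟨ 0 , x ⟩) ⟨ 0 ,_⟩
    (λ u x≈u → inner-≈ x≈u meets) (λ _ _ _ _ e → proj₂ (pair-inj e))

  inner-≼⁻ : ∀ {p} → fst p ≡ 0 → cls mixture p ≼ cls R (snd p)
  inner-≼⁻ {p} fp = injection⇒≼ (cls mixture p) (cls R (snd p)) snd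
    (λ u p≈u → proj₁ (inner-≈⁻ fp p≈u)) (λ _ _ → snd-injective)

  row-≼ : ∀ {i s} → row i s ≡ 0 → row i ≼ cls mixture ⟨ suc i , s ⟩
  row-≼ {i} {s} Ds = injection⇒≼ (row i) (cls mixture ⟨ suc i , s ⟩) ⟨ suc i ,_⟩
    (λ u → row-≈ Ds) (λ _ _ _ _ e → proj₂ (pair-inj e))

  row-≼⁻ : ∀ {p i} → fst p ≡ suc i → cls mixture p ≼ row i
  row-≼⁻ {p} {i} fp = injection⇒≼ (cls mixture p) (row i) snd (λ u → snd-in-row) (λ _ _ → snd-injective)
    where
    snd-in-row : ∀ {u} → mixture ⊢ p ≈ u → row i (snd u) ≡ 0
    snd-in-row e with view e
    ... | inner fp′ _ _ _ = ⊥-elim (0≢1+n (trans (sym fp′) fp))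
    ... | in-row j fp′ _ _ Du with suc-injective (trans (sym fp) fp′)
    ...   | refl = Du

module Sequences (em : ExcludedMiddle 0ℓ) where

  -- Values are chosen one after another, each outside the classes of all earlier values.
  fresh-sequence : ∀ S (P : ℕ → Set) (Good : ℕ → ℕ → Set) →
    (∀ n → P n → ∀ L → Σ ℕ λ y → Good n y × ¬ Meets S y L) →
    Σ (ℕ → ℕ) λ τ → (∀ n → P n → Good n (τ n)) × (∀ {i j} → P i → P j → S ⊢ τ i ≈ τ j → i ≡ j)
  fresh-sequence S P Good choose = τ , (λ n Pn → proj₁ (τ-good n Pn)) , separates
    where
    next : ∀ {n} → Dec (P n) → List ℕ → ℕ
    next (yes Pn) L = proj₁ (choose _ Pn L)
    next (no _)   L = 0
    history : ℕ → List ℕ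
    history zero    = []
    history (suc n) = next {n} em (history n) ∷ history n
    τ : ℕ → ℕ
    τ n = next {n} em (history n)
    τ-good : ∀ n → P n → Good n (τ n) × ¬ Meets S (τ n) (history n)
    τ-good n Pn with em {P n}
    ... | yes Pn′ = proj₂ (choose n Pn′ (history n))
    ... | no ¬Pn  = ⊥-elim (¬Pn Pn)
    earlier : ∀ {i j} → i <′ j → τ i ∈ history j
    earlier ≤′-refl       = here refl
    earlier (≤′-step i<j) = there (earlier i<j)
    separates-< : ∀ {i j} → P j → i < j → ¬ S ⊢ τ j ≈ τ i
    separates-< {i} {j} Pj i<j e = proj₂ (τ-good j Pj) (lose (earlier (≤⇒≤′ i<j)) e)
    separates : ∀ {i j} → P i → P j → S ⊢ τ i ≈ τ j → i ≡ j
    separates {i} {j} Pi Pj e with <-cmp i j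
    ... | tri< i<j _ _ = ⊥-elim (separates-< Pj i<j (sym≈ S e))
    ... | tri≈ _ i≡j _ = i≡j
    ... | tri> _ _ j<i = ⊥-elim (separates-< Pi j<i e)

  module _ (R : Per) (L : List ℕ) (D : Fn 2) where
    open Mixture R L D

    private
      fst-bound : ∀ L′ → Σ ℕ λ k → ∀ y → Meets mixture y L′ → fst y ≤ k
      fst-bound [] = 0 , λ _ ()
      fst-bound (r ∷ L′) = let k , bound = fst-bound L′ in fst r + k , λ
        { y (here y≈r) → ≤-trans (≤-reflexive (mixture-fst y≈r)) (m≤m+n _ k)
        ; y (there p)  → ≤-trans (bound y p) (m≤n+m k _) }

    -- Classes meeting L go to their copies, the others to successive rows that are large enough.
    -- Finitely many elements lie in boundedly many rows, so a suitable row of large index is fresh.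
    into-mixture :
      (∀ x → R ⊢ x ≈ x → ¬ Meets R x L → ∀ k → Σ ℕ λ i → k ≤ i × cls R x ≼ row i × Σ ℕ λ s → row i s ≡ 0) →
      Σ (ℕ → ℕ) (Emb R mixture)
    into-mixture rows = classMap⇒emb (glued-classMap gluing)
      where
      special : Pred
      special = app₁ (meetsᶠ R L)
      Ordinary : ℕ → Set
      Ordinary n = R ⊢ n ≈ n × special n ≢ 0
      Good : ℕ → ℕ → Set
      Good n y = Σ ℕ λ i → Σ ℕ λ s → y ≡ ⟨ suc i , s ⟩ × row i s ≡ 0 × cls R n ≼ row i
      choose : ∀ n → Ordinary n → ∀ L′ → Σ ℕ λ y → Good n y × ¬ Meets mixture y L′
      choose n (n≈n , ¬s) L′ =
        let k , bound = fst-bound L′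
            i , k≤i , n≼i , s , Ds = rows n n≈n (λ meets → ¬s (meetsᶠ-complete R L n meets)) k
        in ⟨ suc i , s ⟩ , (i , s , refl , Ds , n≼i) , λ meets →
          <-irrefl refl (<-≤-trans (s≤s k≤i) (subst (_≤ k) (fst-pair (suc i) s) (bound _ meets)))
      sequence = fresh-sequence mixture Ordinary Good choose
      τ : ℕ → ℕ
      τ = proj₁ sequence
      good : ∀ n → Ordinary n → Good n (τ n)
      good = proj₁ (proj₂ sequence)
      gluing : Gluing R mixture special ⟨ 0 ,_⟩ τ
      gluing = record
        { special-resp = λ {x} {y} x≈y sx → meetsᶠ-complete R L y (Meets-resp R L x≈y (meetsᶠ-sound R L x sx))
        ; η-preserves  = λ {x} x≈y sx → inner-≈ x≈y (meetsᶠ-sound R L x sx)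
        ; η-reflects   = λ {x} {y} _ _ _ _ e → subst₂ (R ⊢_≈_) (snd-pair 0 x) (snd-pair 0 y)
            (proj₁ (inner-≈⁻ (fst-pair 0 x) e))
        ; η-size       = λ {x} _ sx → inner-≼ (meetsᶠ-sound R L x sx)
        ; τ-dom        = λ {n} o → let i , s , e , Ds , _ = good n o in
            subst (λ z → mixture ⊢ z ≈ z) (sym e) (row-≈ Ds Ds)
        ; τ-separates  = proj₂ (proj₂ sequence)
        ; τ-avoids     = λ {n} {x} o _ _ e → let i , s , e′ , _ = good n o in
            1+n≢0 (trans (sym (fst-pair (suc i) s)) (trans (cong fst (sym e′)) (trans (mixture-fst e) (fst-pair 0 x))))
        ; τ-size       = λ {n} o → let i , s , e , Ds , n≼i = good n o in
            subst (λ z → cls R n ≼ cls mixture z) (sym e)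
              (≼-trans (cls R n) (row i) (cls mixture ⟨ suc i , s ⟩) n≼i (row-≼ Ds))
        }

    out-of-mixture :
      (∀ i s → row i s ≡ 0 → ∀ L′ → Σ ℕ λ y → R ⊢ y ≈ y × ¬ Meets R y L′ × row i ≼ cls R y) →
      Σ (ℕ → ℕ) (Emb mixture R)
    out-of-mixture classes = classMap⇒emb (glued-classMap gluing)
      where
      Ordinary : ℕ → Set
      Ordinary n = mixture ⊢ n ≈ n × fst n ≢ 0
      Good : ℕ → ℕ → Set
      Good n y = R ⊢ y ≈ y × ¬ Meets R y L × cls mixture n ≼ cls R y
      choose : ∀ n → Ordinary n → ∀ L′ → Σ ℕ λ y → Good n y × ¬ Meets R y L′
      choose n (n≈n , ¬s) L′ with mixture-view n≈n
      ... | inner fn _ _ _ = ⊥-elim (¬s fn)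
      ... | in-row i fn _ Dn _ =
        -- Avoiding L as well keeps the images of rows apart from the classes copied from R.
        let y , y≈y , apart , i≼y = classes i (snd n) Dn (L′ ++ L)
        in y , (y≈y , (λ meets → apart (++⁺ʳ L′ meets)) , ≼-trans (cls mixture n) (row i) (cls R y) (row-≼⁻ fn) i≼y) ,
           λ meets → apart (++⁺ˡ meets)
      sequence = fresh-sequence R Ordinary Good choose
      τ : ℕ → ℕ
      τ = proj₁ sequence
      good : ∀ n → Ordinary n → Good n (τ n)
      good = proj₁ (proj₂ sequence)
      gluing : Gluing mixture R fst snd τ
      gluing = record
        { special-resp = λ x≈y fx → trans (sym (mixture-fst x≈y)) fx
        ; η-preserves  = λ x≈y fx → proj₁ (inner-≈⁻ fx x≈y)
        ; η-reflects   = λ {x} {y} x≈x _ fx fy e → subst₂ (mixture ⊢_≈_)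
            (trans (cong ⟨_, snd x ⟩ (sym fx)) (pair-surj x)) (trans (cong ⟨_, snd y ⟩ (sym fy)) (pair-surj y))
            (inner-≈ e (proj₂ (inner-≈⁻ fx x≈x)))
        ; η-size       = λ _ fx → inner-≼⁻ fx
        ; τ-dom        = λ {n} o → proj₁ (good n o)
        ; τ-separates  = proj₂ (proj₂ sequence)
        ; τ-avoids     = λ {n} o x≈x fx e → proj₁ (proj₂ (good n o))
            (Meets-resp R L (sym≈ R e) (proj₂ (inner-≈⁻ fx x≈x)))
        ; τ-size       = λ {n} o → proj₂ (proj₂ (good n o))
        }

-- Class sizes that encode settling times.

Covered : Pred → Set
Covered p = Σ (List ℕ) λ l → ∀ u → p u ≡ 0 → u ∈ l

Big-beyond : ∀ {p} n → Big p (suc n) → Σ ℕ λ t → n ≤ t × p t ≡ 0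
Big-beyond {p} n (N , le) with nth p N n le
... | t , pt , c = t , subst (_≤ t) c (count-≤ p t) , pt

covered-≼ : ∀ {p q} ((l , _) : Covered p) → Big q (length l) → p ≼ q
covered-≼ {p} {q} (l , cover) big N = Big-mono {q} (count-cover p N l cover) big

everything-≼ : ∀ {p q} → (∀ s → q s ≡ 0) → p ≼ q
everything-≼ {p} {q} all = injection⇒≼ p q id (λ u _ → all u) (λ _ _ _ _ e → e)

settles : ℕ → ℕ → Set
settles e t = app₂ settlesᶠ e t ≡ 0

module SlowClasses where
  -- Row e is {0} ∪ { s | t ≤ s ≤ 2t } if e settles after t steps and {0} if e
  -- never settles; row i of the standard structure is { s | s ≤ i }.
  slowᶠ standardᶠ : Fn 2
  slowᶠ = v1 *ᶠ prodᶠ (settlesᶠ ⟦ v1 ∷ v0 ∷ [] ⟧ +ᶠ (v2 ∸ᶠ (v0 +ᶠ v0))) ⟦ sucᶠ v1 ∷ v0 ∷ v1 ∷ [] ⟧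
  standardᶠ = v1 ∸ᶠ v0

  slow standard : ℕ → Pred
  slow     = app₂ slowᶠ
  standard = app₂ standardᶠ

  slow-view : ∀ e s → slow e s ≡ 0 → s ≡ 0 ⊎ Σ ℕ λ t → settles e t × s ≤ t + t
  slow-view e s eq with m*n≡0⇒m≡0∨n≡0 s eq
  ... | inj₁ s≡0 = inj₁ s≡0
  ... | inj₂ eq′ =
    let t , _ , h = prod<-sound (suc s) (λ t → app₂ settlesᶠ e t + (s ∸ (t + t))) eq′
    in inj₂ (t , m+n≡0⇒m≡0 _ h , m∸n≡0⇒m≤n (m+n≡0⇒n≡0 (app₂ settlesᶠ e t) h))

  -- The interval has t + 1 elements. It starts at t, so a search for settling times up to s decides
  -- whether s is in the row.
  slow-big : ∀ {e t} → settles e t → Big (slow e) (suc t)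
  slow-big {e} {t} h = suc (t + t) , subst (_≤ count (slow e) (suc (t + t))) (count-all (λ _ → 0) (suc t) (λ _ _ → refl))
    (count-injection (λ _ → 0) (suc t) (t +_) (suc (t + t)) (slow e)
      (λ j j<st _ → s≤s (+-monoʳ-≤ t (≤-pred j<st)) , in-slow j (≤-pred j<st))
      (λ i j _ _ → +-cancelˡ-≡ t i j))
    where
    in-slow : ∀ j → j ≤ t → slow e (t + j) ≡ 0
    in-slow j j≤t = trans (cong ((t + j) *_) (prod<-complete (suc (t + j)) (λ u → app₂ settlesᶠ e u + ((t + j) ∸ (u + u))) t (s≤s (m≤m+n t j))
      (cong₂ _+_ h (m≤n⇒m∸n≡0 (+-monoʳ-≤ t j≤t))))) (*-zeroʳ (t + j))

  standard-covered : ∀ i → Covered (standard i)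
  standard-covered i = downFrom (suc i) , λ u e → ∈-downFrom⁺ (s≤s (m∸n≡0⇒m≤n e))

  standard-count : ∀ i N → count (standard i) N ≤ suc i
  standard-count i N = subst (count (standard i) N ≤_) (length-downFrom (suc i))
    (count-cover (standard i) N (downFrom (suc i)) (proj₂ (standard-covered i)))

  standard-big : ∀ i → Big (standard i) (suc i)
  standard-big i = suc i , ≤-reflexive (sym (count-all (standard i) (suc i) (λ u u<si → m≤n⇒m∸n≡0 (≤-pred u<si))))

module TrueStages where
  -- p = ⟨ e , t ⟩ is a stage if e settles after t steps; row p grows until a
  -- later stage q with fst q < fst p appears, so it is infinite iff p is a
  -- true stage in the sense of Dekker's deficiency set.
  Stage : ℕ → Set
  Stage p = settles (fst p) (snd p)

  stageᶠ : Fn 1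
  stageᶠ = settlesᶠ ⟦ fstᶠ v0 ∷ sndᶠ v0 ∷ [] ⟧

  True : ℕ → Set
  True p = Stage p × ∀ q → p < q → Stage q → fst p ≤ fst q

  opaque
    -- At q and p, `injuryᶠ` vanishes when q is a stage after p with smaller program index; at p and
    -- s, `deficiencyᶠ` vanishes when p is a stage that no q up to s injures.
    injuryᶠ deficiencyᶠ : Fn 2
    injuryᶠ = (sucᶠ v1 ∸ᶠ v0) +ᶠ stageᶠ ⟦ v0 ∷ [] ⟧ +ᶠ (sucᶠ (fstᶠ v0) ∸ᶠ fstᶠ v1)
    deficiencyᶠ = stageᶠ ⟦ v0 ∷ [] ⟧ +ᶠ (const 1 ∸ᶠ prodᶠ injuryᶠ ⟦ sucᶠ v1 ∷ v0 ∷ [] ⟧)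

  deficiency : ℕ → Pred
  deficiency = app₂ deficiencyᶠ

  opaque
    unfolding deficiencyᶠ

    true⇒deficiency : ∀ {p} → True p → ∀ s → deficiency p s ≡ 0
    true⇒deficiency {p} (stage , uninjured) s = cong₂ _+_ stage (≢0⇒∸ λ e →
      let q , _ , inj = prod<-sound (suc s) (λ q → app₂ injuryᶠ q p) e
          inj′ = m+n≡0⇒m≡0 ((suc p ∸ q) + app₁ stageᶠ q) inj
      in <-irrefl refl (<-≤-trans
        (m∸n≡0⇒m≤n (m+n≡0⇒n≡0 ((suc p ∸ q) + app₁ stageᶠ q) inj))
        (uninjured q (m∸n≡0⇒m≤n (m+n≡0⇒m≡0 (suc p ∸ q) inj′)) (m+n≡0⇒n≡0 (suc p ∸ q) inj′))))

    deficiency⇒stage : ∀ {p s} → deficiency p s ≡ 0 → Stage p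
    deficiency⇒stage e = m+n≡0⇒m≡0 _ e

    deficiency⇒uninjured : ∀ {p s} → deficiency p s ≡ 0 → ∀ q → q ≤ s → p < q → Stage q → fst p ≤ fst q
    deficiency⇒uninjured {p} {s} e q q≤s p<q stage = ≮⇒≥ λ q<p →
      ∸-zero (m+n≡0⇒n≡0 (app₁ stageᶠ p) e) (prod<-complete (suc s) (λ q → app₂ injuryᶠ q p) q (s≤s q≤s)
        (cong₂ _+_ (cong₂ _+_ (m≤n⇒m∸n≡0 p<q) stage) (m≤n⇒m∸n≡0 q<p)))

  -- An infinite row has an element beyond any given q, and that element testifies that q does not
  -- injure p.
  infinite⇒true : ∀ {p} → (∀ m → Big (deficiency p) m) → True p
  infinite⇒true {p} big =
    (let s , _ , e = Big-beyond {deficiency p} 0 (big 1) in deficiency⇒stage {p} {s} e) ,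
    λ q p<q stage → let s , q≤s , e = Big-beyond {deficiency p} q (big (suc q)) in
      deficiency⇒uninjured {p} {s} e q q≤s p<q stage

  true-injective : ∀ {p q} → True p → True q → fst p ≡ fst q → p ≡ q
  true-injective {p} {q} (stage , _) (stage′ , _) e = begin
    p                 ≡⟨ sym (pair-surj p) ⟩
    ⟨ fst p , snd p ⟩ ≡⟨ cong₂ ⟨_,_⟩ e (settles-unique (subst (λ z → settles z (snd p)) e stage) stage′) ⟩
    ⟨ fst q , snd q ⟩ ≡⟨ pair-surj q ⟩
    q                 ∎
    where open ≡-Reasoning

  -- Were `⟨ e , t ⟩` to come after p, it would be a later stage of smaller index. So it is at most
  -- p, and t is at most `⟨ e , t ⟩`.
  true-settles : ∀ {p e t} → True p → e < fst p → settles e t → t ≤ p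
  true-settles {p} {e} {t} (_ , uninjured) e<p h = ≤-trans (snd≤ e t) (≮⇒≥ λ p<q →
    <-irrefl refl (<-≤-trans e<p (subst (fst p ≤_) (fst-pair e t)
      (uninjured ⟨ e , t ⟩ p<q (subst₂ settles (sym (fst-pair e t)) (sym (snd-pair e t)) h)))))

-- Diagonal arguments against computable embeddings.

module Diagonal (em : ExcludedMiddle 0ℓ) where
  open SlowClasses
  open TrueStages
  open Mixture

  settling-bound : ∀ N → Σ ℕ λ b → ∀ e t → e < N → settles e t → t ≤ b
  settling-bound zero = 0 , λ _ _ ()
  settling-bound (suc N) with settling-bound N | em {Σ ℕ (settles N)}
  ... | b , bound | yes (t , h) = t + b , λ e t′ e<sN h′ → bounded (m≤n⇒m<n∨m≡n (≤-pred e<sN)) h′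
    where
    bounded : ∀ {e t′} → e < N ⊎ e ≡ N → settles e t′ → t′ ≤ t + b
    bounded (inj₁ e<N) h′  = ≤-trans (bound _ _ e<N h′) (m≤n+m b t)
    bounded (inj₂ refl) h′ = ≤-trans (≤-reflexive (settles-unique h′ h)) (m≤m+n t b)
  ... | b , bound | no never = b , λ e t e<sN h → bounded (m≤n⇒m<n∨m≡n (≤-pred e<sN)) h
    where
    bounded : ∀ {e t} → e < N ⊎ e ≡ N → settles e t → t ≤ b
    bounded (inj₁ e<N) h  = bound _ _ e<N h
    bounded (inj₂ refl) h = ⊥-elim (never (_ , h))

  -- Otherwise b + m would bound all settling times, where b bounds those of the finitely many
  -- programs below N.
  slow-settler : ∀ m N → Σ ℕ λ e → Σ ℕ λ t → N ≤ e × m ≤ t × settles e t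
  slow-settler m N with em {Σ ℕ λ e → Σ ℕ λ t → N ≤ e × m ≤ t × settles e t} | settling-bound N
  ... | yes found | _ = found
  ... | no none | b , bound = ⊥-elim (settling-time-unbounded (const (b + m)) bounded)
    where
    bounded : ∀ e t → settles e t → t ≤ b + m
    bounded e t h with e <? N
    ... | yes e<N = ≤-trans (bound e t e<N h) (m≤m+n b m)
    ... | no e≮N  = ≤-trans (<⇒≤ (≰⇒> λ m≤t → none (e , t , ≮⇒≥ e≮N , m≤t , h))) (m≤n+m m b)

  slow-covered : ∀ e → Covered (slow e)
  slow-covered e with em {Σ ℕ (settles e)}
  ... | yes (t , h) = downFrom (suc (t + t)) , λ u eq → ∈-downFrom⁺ (s≤s (bounded u (slow-view e u eq)))
    where
    bounded : ∀ u → u ≡ 0 ⊎ (Σ ℕ λ t′ → settles e t′ × u ≤ t′ + t′) → u ≤ t + t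
    bounded u (inj₁ refl) = z≤n
    bounded u (inj₂ (t′ , h′ , u≤)) = subst (λ z → u ≤ z + z) (settles-unique h′ h) u≤
  ... | no never = 0 ∷ [] , λ u eq → here ([ id , (λ (t , h , _) → ⊥-elim (never (t , h))) ]′ (slow-view e u eq))

  -- The row of an e settling at t has more than t elements, so a standard row receiving it has
  -- index at least t, and this index is computable from e. The finitely many classes copied from R′
  -- each receive at most one row; the constant B takes care of those.
  slow-not-into-standard : ∀ {R L R′ L′} (f : Fn 1) →
    ¬ Emb (mixture R L slowᶠ) (mixture R′ L′ standardᶠ) (app₁ f)
  slow-not-into-standard {R} {L} {R′} {L′} f F = settling-time-unbounded (const B +ᶠ fstᶠ (f ⟦ pairᶠ (sucᶠ v0) (const 0) ∷ [] ⟧)) bounded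
    where
    M M′ : Per
    M  = mixture R L slowᶠ
    M′ = mixture R′ L′ standardᶠ
    point y : ℕ → ℕ
    -- Every slow row contains 0, so a point of row e is known whether or not e settles.
    point e = ⟨ suc e , 0 ⟩
    y e = app₁ f (point e)
    point≈ : ∀ e → M ⊢ point e ≈ point e
    point≈ e = row-≈ R L slowᶠ {e} {0} {0} refl refl
    y≈ : ∀ e → M′ ⊢ y e ≈ y e
    y≈ e = Emb.preserves F (point≈ e)
    same-settler : ∀ {e e′} → M′ ⊢ y e ≈ y e′ → e ≡ e′
    same-settler {e} {e′} eq = suc-injective (subst₂ _≡_ (fst-pair (suc e) 0) (fst-pair (suc e′) 0)
      (mixture-fst R L slowᶠ (Emb.reflects F (point≈ e) (point≈ e′) eq)))
    inner-bound : ∀ K → Σ ℕ λ b → ∀ e t → settles e t → fst (y e) ≡ 0 → Meets R′ (snd (y e)) K → t ≤ b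
    inner-bound [] = 0 , λ _ _ _ _ ()
    inner-bound (r ∷ K) with inner-bound K | em {Σ ℕ λ e → Σ ℕ λ t → settles e t × fst (y e) ≡ 0 × R′ ⊢ snd (y e) ≈ r}
    ... | b , bound | no none = b , λ
      { e t h fy (here y≈r) → ⊥-elim (none (e , t , h , fy , y≈r))
      ; e t h fy (there p)  → bound e t h fy p }
    ... | b , bound | yes (e′ , t′ , h′ , fy′ , y≈r′) = t′ + b , λ
      { e t h fy (here y≈r) → ≤-trans (≤-reflexive (same e t h fy y≈r)) (m≤m+n t′ b)
      ; e t h fy (there p)  → ≤-trans (bound e t h fy p) (m≤n+m b t′) }
      where
      inner-y : ∀ {e} → fst (y e) ≡ 0 → ⟨ 0 , snd (y e) ⟩ ≡ y e
      inner-y {e} fy = trans (cong ⟨_, snd (y e) ⟩ (sym fy)) (pair-surj (y e))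
      same : ∀ e t → settles e t → fst (y e) ≡ 0 → R′ ⊢ snd (y e) ≈ r → t ≡ t′
      same e t h fy y≈r = settles-unique (subst (λ z → settles z t) (same-settler y≈y′) h) h′
        where
        y≈y′ : M′ ⊢ y e ≈ y e′
        y≈y′ = subst₂ (M′ ⊢_≈_) (inner-y fy) (inner-y fy′)
          (inner-≈ R′ L′ standardᶠ (trans≈ R′ y≈r (sym≈ R′ y≈r′)) (proj₂ (inner-≈⁻ R′ L′ standardᶠ fy (y≈ e))))
    B : ℕ
    B = proj₁ (inner-bound L′)
    bounded : ∀ e t → settles e t → t ≤ B + fst (y e)
    bounded e t h with mixture-view R′ L′ standardᶠ (y≈ e)
    ... | inner fy _ _ meets = ≤-trans (proj₂ (inner-bound L′) e t h fy meets) (m≤m+n B _)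
    ... | in-row i fy _ _ _ =
      let N , le = ≼-Big {cls M′ (y e)} {standard i} (row-≼⁻ R′ L′ standardᶠ fy)
                     (≼-Big {cls M (point e)} {cls M′ (y e)} (emb-≼ F (point e))
                       (≼-Big {slow e} {cls M (point e)} (row-≼ R L slowᶠ {e} {0} refl) (slow-big {e} h)))
      in ≤-trans (<⇒≤ (≤-trans le (standard-count i N))) (≤-trans (≤-reflexive (sym fy)) (m≤n+m _ B))

  -- A stage of least program index among the stages from k on is true; it is reached by descent on
  -- the index.
  true-stage : ∀ k → Σ ℕ λ p → k ≤ p × True p
  true-stage k = let e , t , k≤e , _ , h = slow-settler 0 k in
    descend e ⟨ e , t ⟩ (≤-trans k≤e (fst≤ e t)) (subst₂ settles (sym (fst-pair e t)) (sym (snd-pair e t)) h)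
      (≤-reflexive (fst-pair e t))
    where
    descend : ∀ v q → k ≤ q → Stage q → fst q ≤ v → Σ ℕ λ p → k ≤ p × True p
    descend v q k≤q stage q≤v with em {Σ ℕ λ q′ → k ≤ q′ × Stage q′ × fst q′ < fst q}
    descend v q k≤q stage q≤v | no least = q , k≤q , stage , λ q′ q<q′ stage′ →
      ≮⇒≥ λ lower → least (q′ , ≤-trans k≤q (<⇒≤ q<q′) , stage′ , lower)
    descend zero q k≤q stage q≤v | yes (_ , _ , _ , lower) = ⊥-elim (n≮0 (<-≤-trans lower q≤v))
    descend (suc v) q k≤q stage q≤v | yes (q′ , k≤q′ , stage′ , lower) =
      descend v q′ k≤q′ stage′ (≤-pred (≤-trans lower q≤v))

  -- Infinite rows must land in infinite rows, that is, at true stages, and distinct rows at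
  -- distinct ones. A true stage of index above e bounds the settling time of e; the sum of the
  -- first e + 2 stages found is at least such a stage.
  full-not-into-deficiency : ∀ {R L R′} (f : Fn 1) →
    ¬ Emb (mixture R L (const 0)) (mixture R′ [] deficiencyᶠ) (app₁ f)
  full-not-into-deficiency {R} {L} {R′} f F = settling-time-unbounded
    (sumᶠ (predᶠ (fstᶠ (f ⟦ pairᶠ (sucᶠ v0) (const 0) ∷ [] ⟧))) ⟦ sucᶠ (sucᶠ v0) ∷ [] ⟧) bounded
    where
    M M′ : Per
    M  = mixture R L (const 0)
    M′ = mixture R′ [] deficiencyᶠ
    point y stage : ℕ → ℕ
    point n = ⟨ suc n , 0 ⟩
    y n = app₁ f (point n)
    stage n = pred (fst (y n))
    point≈ : ∀ n → M ⊢ point n ≈ point n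
    point≈ n = row-≈ R L (const 0) {n} {0} {0} refl refl
    y-view : ∀ n → fst (y n) ≡ suc (stage n) × deficiency (stage n) (snd (y n)) ≡ 0
    y-view n with mixture-view R′ [] deficiencyᶠ (Emb.preserves F (point≈ n))
    ... | inner _ _ _ ()
    ... | in-row i fy _ D _ = trans fy (cong suc (sym (cong pred fy))) ,
      subst (λ z → deficiency z (snd (y n)) ≡ 0) (sym (cong pred fy)) D
    y-surj : ∀ n → ⟨ suc (stage n) , snd (y n) ⟩ ≡ y n
    y-surj n = trans (cong ⟨_, snd (y n) ⟩ (sym (proj₁ (y-view n)))) (pair-surj (y n))
    stage-true : ∀ n → True (stage n)
    stage-true n = infinite⇒true λ m →
      ≼-Big {cls M′ (y n)} {deficiency (stage n)} (row-≼⁻ R′ [] deficiencyᶠ (proj₁ (y-view n)))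
        (≼-Big {cls M (point n)} {cls M′ (y n)} (emb-≼ F (point n))
          (≼-Big {λ _ → 0} {cls M (point n)} (row-≼ R L (const 0) {n} {0} refl)
            (m , ≤-reflexive (sym (count-all (λ _ → 0) m (λ _ _ → refl))))))
    stage-injective : ∀ {m n} → fst (stage m) ≡ fst (stage n) → m ≡ n
    stage-injective {m} {n} e = suc-injective (subst₂ _≡_ (fst-pair (suc m) 0) (fst-pair (suc n) 0)
      (mixture-fst R L (const 0) (Emb.reflects F (point≈ m) (point≈ n) ym≈yn)))
      where
      same : stage m ≡ stage n
      same = true-injective (stage-true m) (stage-true n) e
      ym≈yn : M′ ⊢ y m ≈ y n
      ym≈yn = subst₂ (M′ ⊢_≈_) (y-surj m) (y-surj n)
        (subst (λ z → M′ ⊢ ⟨ suc (stage m) , snd (y m) ⟩ ≈ ⟨ suc z , snd (y n) ⟩) same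
          (row-≈ R′ [] deficiencyᶠ (proj₂ (y-view m))
            (subst (λ z → deficiency z (snd (y n)) ≡ 0) (sym same) (proj₂ (y-view n)))))
    -- The first e + 2 true stages found have distinct indices, so one exceeds e.
    large-stage : ∀ e → Σ ℕ λ n → n < 2 + e × e < fst (stage n)
    large-stage e with em {Σ ℕ λ n → n < 2 + e × e < fst (stage n)}
    ... | yes found = found
    ... | no none = ⊥-elim (<-irrefl refl (begin-strict
      suc e                            <⟨ ≤-refl ⟩
      2 + e                            ≡⟨ sym (count-all (λ _ → 0) (2 + e) (λ _ _ → refl)) ⟩
      count (λ _ → 0) (2 + e)          ≤⟨ count-injection (λ _ → 0) (2 + e) (λ n → fst (stage n)) (suc e) (λ _ → 0)
                                            (λ n n< _ → s≤s (≮⇒≥ λ e< → none (n , n< , e<)) , refl)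
                                            (λ _ _ _ _ → stage-injective) ⟩
      count (λ _ → 0) (suc e)          ≤⟨ count-≤ (λ _ → 0) (suc e) ⟩
      suc e                            ∎))
      where open ≤-Reasoning
    bounded : ∀ e t → settles e t → t ≤ sum< (2 + e) stage
    bounded e t h = let n , n< , e< = large-stage e in
      ≤-trans (true-settles (stage-true n) e< h) (≤-sum< (2 + e) stage n n<)

-- Equivalence structures as partial equivalence relations

record Represents (𝒜 : EqStructure) (R : Per) : Set where
  field
    sound    : ∀ {x y} → R ⊢ x ≈ y → Dom 𝒜 x × Dom 𝒜 y × E 𝒜 x y
    complete : ∀ {x y} → Dom 𝒜 x → Dom 𝒜 y → E 𝒜 x y → R ⊢ x ≈ y

  dom⇒ : ∀ {x} → Dom 𝒜 x → R ⊢ x ≈ x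
  dom⇒ dx = complete dx dx (reflE 𝒜 dx)

  dom⇐ : ∀ {x} → R ⊢ x ≈ x → Dom 𝒜 x
  dom⇐ x≈x = proj₁ (sound x≈x)

module FromStructure (𝒜 : EqStructure) (comp𝒜 : Computable 𝒜) where
  private
    domCode : Code 1
    domCode = proj₁ (proj₁ comp𝒜)
    relCode : Code 2
    relCode = proj₁ (proj₂ comp𝒜)

    InDom : ℕ → Set
    InDom x = (Dom 𝒜 x × Eval domCode (x ∷ []) 1) ⊎ (¬ Dom 𝒜 x × Eval domCode (x ∷ []) 0)

    Related : ℕ → ℕ → Set
    Related x y = (E 𝒜 x y × Eval relCode (x ∷ y ∷ []) 1) ⊎ (¬ E 𝒜 x y × Eval relCode (x ∷ y ∷ []) 0)

    inDom : ∀ x → InDom x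
    inDom = proj₂ (proj₁ comp𝒜)

    related : ∀ x y → Dom 𝒜 x → Dom 𝒜 y → Related x y
    related = proj₂ (proj₂ comp𝒜)

    domValue : ∀ {x} → InDom x → ℕ
    domValue (inj₁ _) = 1
    domValue (inj₂ _) = 0

    domᶠ : Fn 1
    domᶠ = mkFn (λ xs → domValue (inDom (lookup xs zero))) domCode λ { (x ∷ []) → ev x (inDom x) }
      where
      ev : ∀ x (d : InDom x) → Eval domCode (x ∷ []) (domValue d)
      ev x (inj₁ (_ , e)) = e
      ev x (inj₂ (_ , e)) = e

    -- The given code answers 1 for related elements; here the answer is reversed, since `Per` reads
    -- zero as truth.
    relatedValue : ∀ {x y} → Related x y → ℕ
    relatedValue (inj₁ _) = 0
    relatedValue (inj₂ _) = 1

    relValue : ∀ {x y} → InDom x → InDom y → ℕ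
    relValue {x} {y} (inj₁ (dx , _)) (inj₁ (dy , _)) = relatedValue (related x y dx dy)
    relValue         (inj₁ _)        (inj₂ _)        = 1
    relValue         (inj₂ _)        _               = 1

    -- relCode may diverge outside the universe, so it sits in the recursion step
    -- of a primitive recursion over domValue x * domValue y.
    guardedCode : Code 3
    guardedCode = prec (code (const {2} 1))
      (comp (code (const {1} 1 ∸ᶠ v0)) (comp relCode (proj (suc (suc zero)) ∷ proj (suc (suc (suc zero))) ∷ []) ∷ []))

    guarded-yes : ∀ {x y v} → Eval relCode (x ∷ y ∷ []) v → Eval guardedCode (1 ∷ x ∷ y ∷ []) (1 ∸ v)
    guarded-yes {v = v} e = ev-prec-suc (ev-prec-zero (eval (const 1) _))
      (ev-comp (ev-∷ (ev-comp (ev-∷ ev-proj (ev-∷ ev-proj ev-[])) e) ev-[]) (eval (const {1} 1 ∸ᶠ v0) (v ∷ [])))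

    guarded-no : ∀ {x y} → Eval guardedCode (0 ∷ x ∷ y ∷ []) 1
    guarded-no = ev-prec-zero (eval (const 1) _)

    guarded : ∀ {x y} (dx : InDom x) (dy : InDom y) →
      Eval guardedCode (domValue dx * domValue dy ∷ x ∷ y ∷ []) (relValue dx dy)
    guarded {x} {y} (inj₁ (dx , _)) (inj₁ (dy , _)) with related x y dx dy
    ... | inj₁ (_ , e) = guarded-yes e
    ... | inj₂ (_ , e) = guarded-yes e
    guarded (inj₁ _) (inj₂ _) = guarded-no
    guarded (inj₂ _) (inj₁ _) = guarded-no
    guarded (inj₂ _) (inj₂ _) = guarded-no

    relᶠ : Fn 2
    relᶠ = mkFn (λ { (x ∷ y ∷ []) → relValue (inDom x) (inDom y) })
      (comp guardedCode (code guard ∷ proj zero ∷ proj (suc zero) ∷ []))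
      λ { (x ∷ y ∷ []) → ev-comp (ev-∷ (eval guard (x ∷ y ∷ [])) (ev-∷ ev-proj (ev-∷ ev-proj ev-[]))) (guarded (inDom x) (inDom y)) }
      where
      guard : Fn 2
      guard = domᶠ ⟦ v0 ∷ [] ⟧ *ᶠ domᶠ ⟦ v1 ∷ [] ⟧

    rel-sound : ∀ {x y} (dx : InDom x) (dy : InDom y) → relValue dx dy ≡ 0 → Dom 𝒜 x × Dom 𝒜 y × E 𝒜 x y
    rel-sound {x} {y} (inj₁ (dx , _)) (inj₁ (dy , _)) eq with related x y dx dy
    ... | inj₁ (e , _) = dx , dy , e
    rel-sound (inj₁ _) (inj₁ _) () | inj₂ _

    rel-complete : ∀ {x y} (dx : InDom x) (dy : InDom y) → Dom 𝒜 x → Dom 𝒜 y → E 𝒜 x y → relValue dx dy ≡ 0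
    rel-complete {x} {y} (inj₁ (dx , _)) (inj₁ (dy , _)) _ _ e with related x y dx dy
    ... | inj₁ _        = refl
    ... | inj₂ (¬e , _) = ⊥-elim (¬e e)
    rel-complete (inj₁ _) (inj₂ (¬dy , _)) _ dy _ = ⊥-elim (¬dy dy)
    rel-complete (inj₂ (¬dx , _)) _ dx _ _ = ⊥-elim (¬dx dx)

    rel-to : ∀ {x y} → app₂ relᶠ x y ≡ 0 → Dom 𝒜 x × Dom 𝒜 y × E 𝒜 x y
    rel-to {x} {y} = rel-sound (inDom x) (inDom y)

    rel-from : ∀ {x y} → Dom 𝒜 x → Dom 𝒜 y → E 𝒜 x y → app₂ relᶠ x y ≡ 0
    rel-from {x} {y} = rel-complete (inDom x) (inDom y)

  per : Per
  per = record
    { rel    = relᶠ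
    ; sym≈   = λ e → let dx , dy , exy = rel-to e in rel-from dy dx (symE 𝒜 dx dy exy)
    ; trans≈ = λ e e′ → let dx , dy , exy = rel-to e
                            _  , dz , eyz = rel-to e′
                        in rel-from dx dz (transE 𝒜 dx dy dz exy eyz)
    }

  represents : Represents 𝒜 per
  represents = record { sound = rel-to ; complete = rel-from }

structure : Per → EqStructure
structure R = record
  { Dom    = λ x → R ⊢ x ≈ x
  ; E      = R ⊢_≈_
  ; reflE  = id
  ; symE   = λ _ _ → sym≈ R
  ; transE = λ _ _ _ → trans≈ R
  }

structure-represents : ∀ R → Represents (structure R) R
structure-represents R = record { sound = λ e → reflˡ R e , reflʳ R e , e ; complete = λ _ _ → id }

structure-computable : ∀ R → Computable (structure R)
structure-computable R =
  (code domᶠ , λ x → decide (eval domᶠ (x ∷ []))) , (code relᶠ , λ x y _ _ → decide (eval relᶠ (x ∷ y ∷ [])))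
  where
  relᶠ : Fn 2
  relᶠ = const 1 ∸ᶠ rel R
  domᶠ : Fn 1
  domᶠ = relᶠ ⟦ v0 ∷ v0 ∷ [] ⟧
  decide : ∀ {n v} {c : Code n} {xs} → Eval c xs (1 ∸ v) → (v ≡ 0 × Eval c xs 1) ⊎ (v ≢ 0 × Eval c xs 0)
  decide {v = zero}          e = inj₁ (refl , e)
  decide {v = suc v} {c} {xs} e = inj₂ ((λ ()) , subst (Eval c xs) (0∸n≡0 v) e)

module _ {𝒜 ℬ R S} (𝒜∼R : Represents 𝒜 R) (ℬ∼S : Represents ℬ S) where
  private
    module 𝒜∼R = Represents 𝒜∼R
    module ℬ∼S = Represents ℬ∼S

  embedding⇒emb : ∀ {f} → IsEmbedding 𝒜 ℬ f → Emb R S f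
  embedding⇒emb (dom , inj , equiv) = record
    { preserves = λ e → let dx , dy , exy = 𝒜∼R.sound e in
        ℬ∼S.complete (dom _ dx) (dom _ dy) (proj₁ (equiv _ _ dx dy) exy)
    ; reflects  = λ x≈x y≈y e → let dx = 𝒜∼R.dom⇐ x≈x ; dy = 𝒜∼R.dom⇐ y≈y in
        𝒜∼R.complete dx dy (proj₂ (equiv _ _ dx dy) (proj₂ (proj₂ (ℬ∼S.sound e))))
    ; injective = λ x≈x y≈y → inj _ _ (𝒜∼R.dom⇐ x≈x) (𝒜∼R.dom⇐ y≈y)
    }

  emb⇒embedding : ∀ {f} → Emb R S f → IsEmbedding 𝒜 ℬ f
  emb⇒embedding H = dom , (λ x y dx dy → injective (𝒜∼R.dom⇒ dx) (𝒜∼R.dom⇒ dy)) , λ x y dx dy →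
    (λ exy → proj₂ (proj₂ (ℬ∼S.sound (preserves (𝒜∼R.complete dx dy exy))))) ,
    (λ e → proj₂ (proj₂ (𝒜∼R.sound (reflects (𝒜∼R.dom⇒ dx) (𝒜∼R.dom⇒ dy) (ℬ∼S.complete (dom x dx) (dom y dy) e)))))
    where
    open Emb H
    dom : ∀ x → Dom 𝒜 x → Dom ℬ _
    dom x dx = ℬ∼S.dom⇐ (preserves (𝒜∼R.dom⇒ dx))

  ↪c⇒embᶠ : 𝒜 ↪c ℬ → Σ (Fn 1) λ f → Emb R S (app₁ f)
  ↪c⇒embᶠ (f , H , c , ev) = mkFn (λ xs → f (lookup xs zero)) c (λ { (x ∷ []) → ev x }) , embedding⇒emb H

  embᶠ⇒↪c : (Σ (Fn 1) λ f → Emb R S (app₁ f)) → 𝒜 ↪c ℬ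
  embᶠ⇒↪c (f , H) = app₁ f , emb⇒embedding H , code f , λ x → eval f (x ∷ [])

-- The two implications.

CategoricalPer : Per → Set
CategoricalPer R = ∀ S → Σ (ℕ → ℕ) (Emb R S) → Σ (ℕ → ℕ) (Emb S R) →
  (Σ (Fn 1) λ f → Emb R S (app₁ f)) × (Σ (Fn 1) λ f → Emb S R (app₁ f))

module Main (em : ExcludedMiddle 0ℓ) where
  open Classical em
  open Sequences em
  open Diagonal em
  open Mixture using (mixture)
  open SlowClasses
  open TrueStages

  -- If p has m elements but not m + 1, a cut below which m of them lie contains them all.
  small⇒cover : ∀ p m → ¬ Big p m → Σ (List ℕ) λ l → (∀ u → p u ≡ 0 → u ∈ l) × length l ≤ m
  small⇒cover p zero ¬big = ⊥-elim (¬big (0 , z≤n))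
  small⇒cover p (suc m) ¬big with em {Big p m}
  ... | no ¬smaller = let l , cover , len = small⇒cover p m ¬smaller in l , cover , m≤n⇒m≤1+n len
  ... | yes (N , le) = elements p N , cover ,
    subst (_≤ suc m) (sym (length-elements p N)) (<⇒≤ (≰⇒> λ big → ¬big (N , big)))
    where
    cover : ∀ u → p u ≡ 0 → u ∈ elements p N
    cover u pu with u <? N
    ... | yes u<N = ∈-elements p N u u<N pu
    ... | no u≮N  = ⊥-elim (¬big (suc u , ≤-trans (s≤s (≤-trans le (count-mono p (≮⇒≥ u≮N))))
                                         (≤-reflexive (sym (count-in p u pu)))))

  covered⊎big : ∀ p → Covered p ⊎ (∀ m → Big p m)
  covered⊎big p with em {Σ ℕ λ m → ¬ Big p m}
  ... | yes (m , ¬big) = let l , cover , _ = small⇒cover p m ¬big in inj₁ (l , cover)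
  ... | no none = inj₂ λ m → [ id , (λ ¬big → ⊥-elim (none (m , ¬big))) ]′ (em⊎ m)
    where
    em⊎ : ∀ m → Big p m ⊎ ¬ Big p m
    em⊎ m with em {Big p m}
    ... | yes big = inj₁ big
    ... | no ¬big = inj₂ ¬big

  module _ {R : Per} (cat : CategoricalPer R) where

    -- If infinitely many classes are infinite, R lies computably between the mixtures
    -- with full rows and with deficiency rows.
    case-infinite : ¬ (∀ L → Σ ℕ λ x → R ⊢ x ≈ x × ¬ Meets R x L × (∀ m → Big (cls R x) m))
    case-infinite rich = full-not-into-deficiency (proj₁ into ∘ᶠ proj₁ from) (emb-∘ (proj₂ from) (proj₂ into))
      where
      classes : ∀ p L′ → Σ ℕ λ y → R ⊢ y ≈ y × ¬ Meets R y L′ × p ≼ cls R y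
      classes p L′ = let y , y≈y , apart , big = rich L′ in y , y≈y , apart , λ N → big _
      from : Σ (Fn 1) λ f → Emb (mixture R [] (const 0)) R (app₁ f)
      from = proj₂ (cat (mixture R [] (const 0))
        (into-mixture R [] (const 0) λ x _ _ k → k , ≤-refl , everything-≼ {cls R x} (λ _ → refl) , 0 , refl)
        (out-of-mixture R [] (const 0) λ i _ _ → classes (λ _ → 0)))
      into : Σ (Fn 1) λ f → Emb R (mixture R [] deficiencyᶠ) (app₁ f)
      into = proj₁ (cat (mixture R [] deficiencyᶠ)
        (into-mixture R [] deficiencyᶠ λ x _ _ k → let p , k≤p , t = true-stage k in
          p , k≤p , everything-≼ {cls R x} (true⇒deficiency t) , 0 , true⇒deficiency t 0)
        (out-of-mixture R [] deficiencyᶠ λ i _ _ → classes (deficiency i)))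

    -- Otherwise R lies computably between the mixtures with slow and with standard rows.
    case-finite : (∀ m → Rich R m) → ∀ L → ¬ (∀ x → R ⊢ x ≈ x → ¬ Meets R x L → Covered (cls R x))
    case-finite rich L finite = slow-not-into-standard (proj₁ into ∘ᶠ proj₁ from) (emb-∘ (proj₂ from) (proj₂ into))
      where
      classes : ∀ {p} → Covered p → ∀ L′ → Σ ℕ λ y → R ⊢ y ≈ y × ¬ Meets R y L′ × p ≼ cls R y
      classes {p} c L′ = let y , y≈y , apart , big = rich (length (proj₁ c)) L′ in
        y , y≈y , apart , covered-≼ {p} {cls R y} c big
      from : Σ (Fn 1) λ f → Emb (mixture R L slowᶠ) R (app₁ f)
      from = proj₂ (cat (mixture R L slowᶠ)
        (into-mixture R L slowᶠ λ x x≈x apart k →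
          let c = finite x x≈x apart
              e , t , k≤e , len≤t , h = slow-settler (length (proj₁ c)) k
          in e , k≤e , covered-≼ {cls R x} {slow e} c (Big-mono {slow e} (m≤n⇒m≤1+n len≤t) (slow-big {e} h)) , 0 , refl)
        (out-of-mixture R L slowᶠ λ i _ _ → classes (slow-covered i)))
      into : Σ (Fn 1) λ f → Emb R (mixture R L standardᶠ) (app₁ f)
      into = proj₁ (cat (mixture R L standardᶠ)
        (into-mixture R L standardᶠ λ x x≈x apart k →
          let c = finite x x≈x apart
              -- One summand makes the row late enough, the other large enough.
              i = k + length (proj₁ c)
          in i , m≤m+n k _ ,
             covered-≼ {cls R x} {standard i} c (Big-mono {standard i} (m≤n⇒m≤1+n (m≤n+m _ k)) (standard-big i)) ,
             0 , 0∸n≡0 i)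
        (out-of-mixture R L standardᶠ λ i _ _ → classes (standard-covered i)))

    -- If no threshold is thin, R is rich at every m. Either all but finitely many classes are
    -- finite, or infinite classes exist outside every finite list; each case is refuted above.
    categorical⇒thin : Σ ℕ (Thin R)
    categorical⇒thin with em {Σ ℕ (Thin R)} | em {Σ (List ℕ) λ L → ∀ x → R ⊢ x ≈ x → ¬ Meets R x L → Covered (cls R x)}
    ... | yes thin | _ = thin
    ... | no ¬thin | yes (L , finite) = ⊥-elim (case-finite (λ m → ¬thin⇒rich R m (λ t → ¬thin (m , t))) L finite)
    ... | no ¬thin | no ¬finite = ⊥-elim (case-infinite infinite-class)
      where
      infinite-class : ∀ L → Σ ℕ λ x → R ⊢ x ≈ x × ¬ Meets R x L × (∀ m → Big (cls R x) m)
      infinite-class L with em {Σ ℕ λ x → R ⊢ x ≈ x × ¬ Meets R x L × (∀ m → Big (cls R x) m)}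
      ... | yes found = found
      ... | no none = ⊥-elim (¬finite (L , λ x x≈x apart →
        [ id , (λ big → ⊥-elim (none (x , x≈x , apart , big))) ]′ (covered⊎big (cls R x))))

  module _ {𝒜 R} (𝒜∼R : Represents 𝒜 R) where
    open Represents 𝒜∼R

    private
      covers⇒ : ∀ {x l} → Covers 𝒜 x l → ∀ u → R ⊢ x ≈ u → u ∈ l
      covers⇒ cov u x≈u = let _ , du , exu = sound x≈u in cov u du exu

      covers⇐ : ∀ {x l} → Dom 𝒜 x → (∀ u → R ⊢ x ≈ u → u ∈ l) → Covers 𝒜 x l
      covers⇐ dx cov y dy exy = cov y (complete dx dy exy)

      covers-resp : ∀ {x r l} → R ⊢ x ≈ r → Covers 𝒜 x l → Covers 𝒜 r l
      covers-resp x≈r cov y dy ery = let _ , dr , _ = sound x≈r in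
        covers⇒ cov y (trans≈ R x≈r (complete dr dy ery))

      -- Needed for the exceptional classes, which may be finite and yet larger than the thinness
      -- threshold.
      size-bound : ∀ L → Σ ℕ λ k → ∀ x → Meets R x L → FiniteClass 𝒜 x → ClassSizeAtMost 𝒜 x k
      size-bound [] = 0 , λ _ ()
      size-bound (r ∷ L) with size-bound L | em {FiniteClass 𝒜 r}
      ... | k , bound | yes (l , cov) = length l + k , λ
        { x (here x≈r) _  → l , covers-resp (sym≈ R x≈r) cov , m≤m+n (length l) k
        ; x (there p) fin → let l′ , cov′ , len = bound x p fin in l′ , cov′ , ≤-trans len (m≤n+m k (length l)) }
      ... | k , bound | no infinite = k , λ
        { x (here x≈r) (l , cov) → ⊥-elim (infinite (l , covers-resp x≈r cov))
        ; x (there p) fin        → bound x p fin }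

    thin⇒bounded : ∀ {m} → Thin R m → FinitelyManyInfiniteClasses 𝒜 × BoundedCharacter 𝒜
    thin⇒bounded {m} (L , cover) = (L , many) , (k + m , character)
      where
      k : ℕ
      k = proj₁ (size-bound L)
      small : ∀ {x} → Dom 𝒜 x → ¬ Big (cls R x) m → ClassSizeAtMost 𝒜 x m
      small {x} dx ¬big = let l , cov , len = small⇒cover (cls R x) m ¬big in l , covers⇐ dx cov , len
      many : ∀ x → Dom 𝒜 x → InfiniteClass 𝒜 x → Any (λ r → Dom 𝒜 r × E 𝒜 x r) L
      many x dx infinite with cover x (dom⇒ dx)
      ... | inj₁ meets = Any.map (λ x≈r → proj₂ (sound x≈r)) meets
      ... | inj₂ ¬big  = let l , cov , _ = small dx ¬big in ⊥-elim (infinite (l , cov))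
      character : ∀ x → Dom 𝒜 x → FiniteClass 𝒜 x → ClassSizeAtMost 𝒜 x (k + m)
      character x dx fin with cover x (dom⇒ dx)
      ... | inj₁ meets = let l , cov , len = proj₂ (size-bound L) x meets fin in l , cov , ≤-trans len (m≤m+n k m)
      ... | inj₂ ¬big  = let l , cov , len = small dx ¬big in l , cov , ≤-trans len (m≤n+m m k)

    bounded⇒thin : FinitelyManyInfiniteClasses 𝒜 → BoundedCharacter 𝒜 → Σ ℕ (Thin R)
    bounded⇒thin (reps , many) (k , character) = suc k , reps , cover
      where
      cover : ∀ x → R ⊢ x ≈ x → Meets R x reps ⊎ ¬ Big (cls R x) (suc k)
      cover x x≈x with em {FiniteClass 𝒜 x}
      ... | no infinite = inj₁ (Any.map (λ (dr , exr) → complete (dom⇐ x≈x) dr exr) (many x (dom⇐ x≈x) infinite))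
      ... | yes fin = let l , cov , len = character x (dom⇐ x≈x) fin in inj₂ λ (N , big) →
        <-irrefl refl (≤-trans big (≤-trans (count-cover (cls R x) N l (covers⇒ cov)) len))

theorem2p6 : ExcludedMiddle 0ℓ → ExcludedMiddle (Level.suc 0ℓ) →
    (𝒜 : EqStructure) → Computable 𝒜 →
    ComputablyBiEmbeddablyCategorical 𝒜 ⇔
    (FinitelyManyInfiniteClasses 𝒜 × BoundedCharacter 𝒜)
theorem2p6 em _ 𝒜 comp𝒜 = mk⇔ necessary sufficient
  where
  open Main em
  open Classical em
  R : Per
  R = FromStructure.per 𝒜 comp𝒜
  𝒜∼R : Represents 𝒜 R
  𝒜∼R = FromStructure.represents 𝒜 comp𝒜
  necessary : ComputablyBiEmbeddablyCategorical 𝒜 → FinitelyManyInfiniteClasses 𝒜 × BoundedCharacter 𝒜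
  necessary cat = thin⇒bounded 𝒜∼R (proj₂ (categorical⇒thin λ S (f , F) (g , G) →
    let 𝒮∼S = structure-represents S
        into , out = cat (structure S) (structure-computable S)
          ((f , emb⇒embedding 𝒜∼R 𝒮∼S F) , (g , emb⇒embedding 𝒮∼S 𝒜∼R G))
    in ↪c⇒embᶠ 𝒜∼R 𝒮∼S into , ↪c⇒embᶠ 𝒮∼S 𝒜∼R out))
  sufficient : FinitelyManyInfiniteClasses 𝒜 × BoundedCharacter 𝒜 → ComputablyBiEmbeddablyCategorical 𝒜
  sufficient (many , character) ℬ compℬ ((f , F) , (g , G)) =
    -- The embedding of ℬ into 𝒜 carries thinness over to ℬ, so one argument makes both embeddings
    -- computable.
    embᶠ⇒↪c 𝒜∼R ℬ∼S (thin⇒embᶠ thin F′) , embᶠ⇒↪c ℬ∼S 𝒜∼R (thin⇒embᶠ (thin-pullback G′ thin) G′)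
    where
    S : Per
    S = FromStructure.per ℬ compℬ
    ℬ∼S : Represents ℬ S
    ℬ∼S = FromStructure.represents ℬ compℬ
    F′ : Emb R S f
    F′ = embedding⇒emb 𝒜∼R ℬ∼S F
    G′ : Emb S R g
    G′ = embedding⇒emb ℬ∼S 𝒜∼R G
    thin : Thin R _
    thin = proj₂ (bounded⇒thin 𝒜∼R many character)
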